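{- There are bipartite network games with general preferences, with arbitrarily large player sets $V$, such that some locally stable matching can be reached by a finite sequence of local improvement steps from the empty matching $M=\emptyset$, but every sequence of local improvement steps from $\emptyset$ ending in a locally stable matching has length $2^{\Omega(|V|)}$.
   Context: A network game consists of a set $V$ of players, a network $N=(V,L)$ whose links are unordered pairs of distinct players, and a set $E$ of potential matching edges. A state is a matching $M\subseteq E$. With general preferences, each player $v$ has a strict preference order over the players $w$ with $\{v,w\}\in E$ and prefers being matched to any of them over being unmatched. The game is bipartite if $V=U\cup W$ (disjoint) and every edge of $E$ joins $U$ and $W$. In state $M$, two players are accessible if their distance in $(V,L\cup M)$ is at most $2$. A local blocking pair of $M$ is a pair $\{u,v\}\in E$ of accessible players each of which is unmatched or strictly prefers the other to its current partner. A locally stable matching is a matching with no local blocking pair. A local improvement step picks a local blocking pair $\{u,v\}$, adds it to $M$ and removes all edges of $M$ incident to $u$ or $v$. -}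

module Defs where

open import Data.Nat using (ℕ; _<_)
open import Data.Fin using (Fin)
open import Data.Bool using (Bool; true; false)
open import Data.Product using (Σ; ∃; _×_; _,_)
open import Data.Sum using (_⊎_)
open import Relation.Binary.PropositionalEquality using (_≡_; _≢_)
open import Relation.Nullary using (¬_)

-- A network game on the player set V = Fin n.
--   link  : the network N = (V, L)      (link u v ≡ true  iff {u,v} ∈ L)
--   edge  : potential matching edges E  (edge u v ≡ true  iff {u,v} ∈ E)
--   rank  : preferences; player v strictly prefers w to w' iff rank v w < rank v w'
record Game (n : ℕ) : Set where
  field
    link : Fin n → Fin n → Bool
    edge : Fin n → Fin n → Bool
    rank : Fin n → Fin n → ℕ
open Game public

record WellFormed {n : ℕ} (G : Game n) : Set where
  field
    link-sym   : ∀ u v → link G u v ≡ true → link G v u ≡ true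
    link-irr   : ∀ u → link G u u ≡ false
    edge-sym   : ∀ u v → edge G u v ≡ true → edge G v u ≡ true
    edge-irr   : ∀ u → edge G u u ≡ false
    rank-inj   : ∀ v w w' → edge G v w ≡ true → edge G v w' ≡ true →
                 rank G v w ≡ rank G v w' → w ≡ w'

Bipartite : {n : ℕ} → Game n → Set
Bipartite {n} G = Σ (Fin n → Bool) λ side → ∀ u v → edge G u v ≡ true → side u ≢ side v

-- A state: a set of edges M, given by its (symmetric) indicator function.
State : ℕ → Set
State n = Fin n → Fin n → Bool

empty : {n : ℕ} → State n
empty _ _ = false

record IsMatching {n : ℕ} (G : Game n) (M : State n) : Set where
  field
    sym     : ∀ u v → M u v ≡ true → M v u ≡ true
    ⊆E      : ∀ u v → M u v ≡ true → edge G u v ≡ true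
    unique  : ∀ u v w → M u v ≡ true → M u w ≡ true → v ≡ w

Adj : {n : ℕ} → Game n → State n → Fin n → Fin n → Set
Adj G M x y = link G x y ≡ true ⊎ M x y ≡ true

Accessible : {n : ℕ} → Game n → State n → Fin n → Fin n → Set
Accessible {n} G M u v = u ≡ v ⊎ Adj G M u v ⊎ Σ (Fin n) λ w → Adj G M u w × Adj G M w v

Unmatched : {n : ℕ} → State n → Fin n → Set
Unmatched M u = ∀ w → M u w ≡ false

WantsSwitch : {n : ℕ} → Game n → State n → Fin n → Fin n → Set
WantsSwitch {n} G M u v =
  Unmatched M u ⊎ Σ (Fin n) λ w → M u w ≡ true × rank G u v < rank G u w

LocalBlockingPair : {n : ℕ} → Game n → State n → Fin n → Fin n → Set
LocalBlockingPair G M u v =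
  edge G u v ≡ true × Accessible G M u v × WantsSwitch G M u v × WantsSwitch G M v u

LocallyStable : {n : ℕ} → Game n → State n → Set
LocallyStable G M = IsMatching G M × (∀ u v → ¬ LocalBlockingPair G M u v)

_∈₂_,_ : {n : ℕ} → Fin n → Fin n → Fin n → Set
x ∈₂ u , v = x ≡ u ⊎ x ≡ v

LocalStep : {n : ℕ} → Game n → State n → State n → Set
LocalStep {n} G M M' = Σ (Fin n) λ u → Σ (Fin n) λ v →
  LocalBlockingPair G M u v ×
  (∀ x y → (M' x y ≡ true) ⇔′
            (((x ≡ u × y ≡ v) ⊎ (x ≡ v × y ≡ u)) ⊎
             (M x y ≡ true × ¬ (x ∈₂ u , v) × ¬ (y ∈₂ u , v))))
  where
  _⇔′_ : Set → Set → Set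
  A ⇔′ B = (A → B) × (B → A)

data Reach {n : ℕ} (G : Game n) : State n → State n → ℕ → Set where
  done : ∀ {M} → Reach G M M 0
  step : ∀ {M M' M'' k} → LocalStep G M M' → Reach G M' M'' k → Reach G M M'' (ℕ.suc k)

{-# OPTIONS --safe #-}

-- The players of level k form a 5-cycle s k 0, ..., s k 4 of links.  "Token k" is a matched edge between
-- levels k + 1 and k; preferences let it walk only around a closed tour which goes once around level k + 1
-- while going twice around level k.  Two tokens that share a level cannot overtake each other unless one of
-- them is destroyed, so as long as all tokens survive token k makes two rounds for each round of token k + 1.
-- Token k can only be created by a seed which has swept level k + 1 against the direction of the tokens, hence
-- only while tokens k and k + 1 are both missing: a destroyed token is not replaced before the top token dies.
-- The tour of the top token is cut open, and a state can only be stable if the top token has reached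
-- the end of its tour and all tokens except possibly token 0 are alive.  Between the last creation of the top
-- token and that moment, token 1 has made exponentially many moves.
module Submission where

open import Defs
open import Data.Nat using (ℕ; zero; suc; _+_; _*_; _∸_; _^_; _/_; _%_; _≤_; _<_; z≤n; s≤s; _≡ᵇ_)
open import Data.Nat.Properties
open import Data.Nat.DivMod using (m%n<n; /-monoˡ-≤; m*n/n≡m)
open import Data.Nat.Tactic.RingSolver using (solve-∀)
open import Data.Fin using (Fin; zero; suc; toℕ; inject₁; remQuot; combine; fromℕ<)
open import Data.Fin.Patterns
open import Data.Fin.Properties using (all?; any?; toℕ≤pred[n]; toℕ-inject₁; toℕ<n; toℕ-injective; toℕ-fromℕ<; combine-remQuot; remQuot-combine) renaming (_≟_ to _≟ᶠ_)
open import Data.Bool using (Bool; true; false; not; if_then_else_)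
open import Data.Bool.Properties using (not-¬; ¬-not) renaming (_≟_ to _≟ᵇ_)
open import Data.Product using (Σ; _×_; _,_; proj₁; proj₂)
open import Data.Sum using (_⊎_; inj₁; inj₂; [_,_]′; swap)
open import Data.Empty using (⊥; ⊥-elim)
open import Relation.Nullary using (¬_; Dec; yes; no; contradiction)
open import Relation.Nullary.Decidable using (from-yes; _→-dec_; _×-dec_; _⊎-dec_; ¬?; ⌊_⌋; map′)
open import Relation.Binary.PropositionalEquality

-- What rules out overtaking is one preference: an `s` player puts the level above before the level
-- below. A token therefore cannot turn onto a player held by the token above it, whereas a token
-- sliding onto a player held by the token below destroys the latter. Unrolling the cycles, each
-- surviving token is strictly ahead of the one above, by less than a round. The count compares two
-- bounds on the unrolled position `out` of token 1 on level 1. When the top token is born, the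
-- others may already be ahead, but `out` is at most `10 * 2 ^ h - 10`. When the top token has
-- finished its tour, its own position on level `h + 1` is 10, and `out` is at least
-- `12 * 2 ^ h - 2`. A step raises `out` by at most one. Since blocked or destroyed tokens could
-- make stability unattainable, reachability needs its own argument: a recursive schedule moves
-- every endangered token out of the way before a slide would destroy it.

-- b k and c k seed token k by sweeping level k + 1 from 4 down to 0; y k has no potential matching edge
-- and only gives b k access to s (suc k) 4.
data Player : Set where
  s     : ℕ → Fin 5 → Player
  b c y : ℕ → Player

-- Arithmetic of the 5-cycles

next : Fin 5 → Fin 5
next 0F = 1F
next 1F = 2F
next 2F = 3F
next 3F = 4F
next 4F = 0F

double : Fin 5 → Fin 5
double 0F = 0F
double 1F = 2F
double 2F = 4F
double 3F = 1F
double 4F = 3F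

-- 2 j + d mod 5: while s (suc k) j holds token k, its partners are, in order, s k (foot j 0), s k (foot j 1)
-- and s k (foot j 2); the last of these is handed over to s (suc k) (next j).
foot : Fin 5 → Fin 3 → Fin 5
foot j 0F = double j
foot j 1F = next (double j)
foot j 2F = next (next (double j))

-- As 3 is -2 modulo 5, this is `i - 2 j`, the inverse of `foot j`, in a form that is total on all
-- pairs.
offset : Fin 5 → Fin 5 → ℕ
offset j i = (toℕ i + 3 * toℕ j) % 5

offset-foot : ∀ j d → offset j (foot j d) ≡ toℕ d
offset-foot = from-yes (all? λ j → all? λ d → offset j (foot j d) ≟ toℕ d)

foot-injective : ∀ j d d′ → foot j d ≡ foot j d′ → d ≡ d′
foot-injective = from-yes (all? λ j → all? λ d → all? λ d′ → (foot j d ≟ᶠ foot j d′) →-dec (d ≟ᶠ d′))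

-- Consecutive visits meet only at the handover, so the upper end of a token can advance only in the
-- last stage.
foot-shared : ∀ j d d′ → foot j d ≡ foot (next j) d′ → d ≡ 2F × d′ ≡ 0F
foot-shared = from-yes (all? λ j → all? λ d → all? λ d′ →
  (foot j d ≟ᶠ foot (next j) d′) →-dec ((d ≟ᶠ 2F) ×-dec (d′ ≟ᶠ 0F)))

foot-turn : ∀ j → foot j 2F ≡ foot (next j) 0F
foot-turn = from-yes (all? λ j → foot j 2F ≟ᶠ foot (next j) 0F)

foot-next : ∀ j d d′ → foot j d′ ≡ next (foot j d) → toℕ d′ ≡ suc (toℕ d)
foot-next = from-yes (all? λ j → all? λ d → all? λ d′ →
  (foot j d′ ≟ᶠ next (foot j d)) →-dec (toℕ d′ ≟ suc (toℕ d)))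

foot-slide : ∀ j (d : Fin 2) → foot j (suc d) ≡ next (foot j (inject₁ d))
foot-slide = from-yes (all? λ j → all? λ d → foot j (suc d) ≟ᶠ next (foot j (inject₁ d)))

-- The players 2 and 4 also have an edge to 0 one level below. The bound on `j`, coming from
-- `finish`, prevents births there, before the sweep is over.
foot-zero : ∀ j d → toℕ j < 2 → 0F ≡ foot j d → j ≡ 0F
foot-zero = from-yes (all? λ j → all? λ d → (toℕ j <? 2) →-dec ((0F ≟ᶠ foot j d) →-dec (j ≟ᶠ 0F)))

next-≢ : ∀ i → next i ≢ i
next-≢ = from-yes (all? λ i → ¬? (next i ≟ᶠ i))

next-< : ∀ i j → toℕ i < toℕ j → j ≢ next i → toℕ (next i) < toℕ j
next-< = from-yes (all? λ i → all? λ j →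
  (toℕ i <? toℕ j) →-dec (¬? (j ≟ᶠ next i) →-dec (toℕ (next i) <? toℕ j)))

next-cases : ∀ i j → j ≡ next i → i ≢ 4F → toℕ j ≡ suc (toℕ i)
next-cases = from-yes (all? λ i → all? λ j →
  (j ≟ᶠ next i) →-dec (¬? (i ≟ᶠ 4F) →-dec (toℕ j ≟ suc (toℕ i))))

below-next : ∀ i j → i ≢ 4F → toℕ j < toℕ (next i) → j ≢ i → toℕ j < toℕ i
below-next = from-yes (all? λ i → all? λ j →
  ¬? (i ≟ᶠ 4F) →-dec ((toℕ j <? toℕ (next i)) →-dec (¬? (j ≟ᶠ i) →-dec (toℕ j <? toℕ i))))

below-four : ∀ (j : Fin 5) → j ≢ 4F → toℕ j < 4
below-four = from-yes (all? λ (j : Fin 5) → ¬? (j ≟ᶠ 4F) →-dec (toℕ j <? 4))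

≢0⇒0< : ∀ (i : Fin 5) → i ≢ 0F → 0 < toℕ i
≢0⇒0< = from-yes (all? λ (i : Fin 5) → ¬? (i ≟ᶠ 0F) →-dec (0 <? toℕ i))

-- Preferences and potential matching edges

isSuc : ℕ → ℕ → Bool
isSuc zero    _       = false
isSuc (suc m) zero    = zero ≡ᵇ m
isSuc (suc m) (suc k) = isSuc m k

isSuc-suc : ∀ k → isSuc (suc k) k ≡ true
isSuc-suc zero    = refl
isSuc-suc (suc k) = isSuc-suc k

isSuc-pred : ∀ k → isSuc k (suc k) ≡ false
isSuc-pred zero    = refl
isSuc-pred (suc k) = isSuc-pred k

-- Smaller is better: s k i prefers level k + 1 to level k - 1 to c to b; in level k - 1 it prefers late stages
-- of its own visit, in level k + 1 the partner whose visit is at an early stage.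
cost : Player → Player → ℕ
cost (s k i) (s l j) = if isSuc l k then offset j i else 10 ∸ offset i j
cost (s _ _) (c _)   = 20
cost (s _ _) (b _)   = 21
cost (b _)   (s _ i) = toℕ i
cost (c _)   (s _ i) = toℕ i
cost _       _       = 0

cost-upper : ∀ k j d → cost (s k (foot j d)) (s (suc k) j) ≡ toℕ d
cost-upper k j d rewrite isSuc-suc k = offset-foot j d

cost-lower : ∀ k j d → cost (s (suc k) j) (s k (foot j d)) ≡ 10 ∸ toℕ d
cost-lower k j d rewrite isSuc-pred k = cong (10 ∸_) (offset-foot j d)

cost-s≤10 : ∀ k i l j → cost (s k i) (s l j) ≤ 10
cost-s≤10 k i l j with isSuc l k
... | true  = ≤-trans (<⇒≤ (m%n<n (toℕ i + 3 * toℕ j) 5)) (m≤m+n 5 5)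
... | false = m∸n≤m 10 (offset i j)

-- A birth goes through a seed linked to `s k 0`. If the sweeping `b k` had that link, a token could
-- be born at 4 or 2 in the middle of a sweep; so the linked seed is `c k`, which takes over at 1
-- and has edges only to 1 and 0.
data Edge₀ : Player → Player → Set where
  token  : ∀ {k j i} d → i ≡ foot j d → Edge₀ (s (suc k) j) (s k i)
  sweep  : ∀ {k i} → i ≢ 0F → Edge₀ (b k) (s (suc k) i)
  finish : ∀ {k i} → toℕ i < 2 → Edge₀ (c k) (s (suc k) i)

Edge : Player → Player → Set
Edge p q = Edge₀ p q ⊎ Edge₀ q p

Edge₀-irrefl : ∀ {p} → ¬ Edge₀ p p
Edge₀-irrefl ()

Seed : Player → ℕ → Set
Seed p k = p ≡ b k ⊎ p ≡ c k

-- Links, accessibility and the invariant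

module Network (n : ℕ) where

  -- The link between 4 and 0 is missing at the top level n, so that the top token has to stop at 4.
  Cut : ℕ → Fin 5 → Set
  Cut k i = k ≡ n × i ≡ 4F

  -- The detour through `y k` uses up both links of an access path. With a direct link from `b k` to
  -- `s (suc k) 4`, the player 3 would be accessible too, and a sweep could start below a token
  -- standing at 4.
  data Link : Player → Player → Set where
    fwd : ∀ {k i i′} → i′ ≡ next i → ¬ Cut k i → Link (s k i) (s k i′)
    bwd : ∀ {k i i′} → i ≡ next i′ → ¬ Cut k i′ → Link (s k i) (s k i′)
    bc : ∀ {k} → Link (b k) (c k)
    cb : ∀ {k} → Link (c k) (b k)
    cs : ∀ {k i} → i ≡ 0F → Link (c k) (s k i)
    sc : ∀ {k i} → i ≡ 0F → Link (s k i) (c k)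
    by : ∀ {k} → Link (b k) (y k)
    yb : ∀ {k} → Link (y k) (b k)
    ys : ∀ {k i} → i ≡ 4F → Link (y k) (s (suc k) i)
    sy : ∀ {k i} → i ≡ 4F → Link (s (suc k) i) (y k)

  Edge₀-unlinked : ∀ {p q} → Edge₀ p q → ¬ Link p q
  Edge₀-unlinked (token _ _) ()
  Edge₀-unlinked (sweep _) ()
  Edge₀-unlinked (finish _) ()

  -- Matchings are studied as relations on the unbounded family of players, which permits pattern
  -- matching on levels; `Lift` later supplies them from states of the finite game.
  Relation : Set₁
  Relation = Player → Player → Set

  Adjacent : Relation → Player → Player → Set
  Adjacent R p q = Link p q ⊎ R p q

  Access : Relation → Player → Player → Set
  Access R p q = p ≡ q ⊎ Adjacent R p q ⊎ Σ Player λ w → Adjacent R p w × Adjacent R w q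

  data Wants (R : Relation) (p q : Player) : Set where
    unmatched : (∀ w → ¬ R p w) → Wants R p q
    improves  : ∀ {w} → R p w → cost p q < cost p w → Wants R p q

  Occupied : Relation → ℕ → Fin 5 → Set
  Occupied R k j = Σ ℕ λ l → Σ (Fin 5) λ i → R (s k j) (s l i)

  record Inv (R : Relation) : Set where
    field
      symm : ∀ {p q} → R p q → R q p
      edges : ∀ {p q} → R p q → Edge p q
      uniq : ∀ {p q q′} → R p q → R p q′ → q ≡ q′
      one  : ∀ {k j j′ i i′} → R (s (suc k) j) (s k i) → R (s (suc k) j′) (s k i′) → j ≡ j′
      -- A sweeping seed stays above all tokens on the level, so it reaches 0 only if there are none.
      seed : ∀ {p k i j} → Seed p k → R p (s (suc k) i) → Occupied R (suc k) j → toℕ j < toℕ i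

  data Sow (R : Relation) : Player → ℕ → Fin 5 → Set where
    enter : ∀ {k} → Sow R (b k) k 4F
    down  : ∀ {k i} → i ≢ 0F → i ≢ 4F → R (b k) (s (suc k) (next i)) → Sow R (b k) k i
    pass  : ∀ {k} → R (b k) (s (suc k) 1F) → Sow R (c k) k 1F
    drop  : ∀ {k} → R (c k) (s (suc k) 1F) → Sow R (c k) k 0F

  -- The asymmetry between the levels shows here: `turn` requires that the token above does not hold
  -- the new upper player, while `slide` has no such condition about the token below, which it may
  -- destroy.
  data Move (R : Relation) : Player → Player → Set where
    slide : ∀ k j (d : Fin 2) → R (s (suc k) j) (s k (foot j (inject₁ d))) →
            Move R (s (suc k) j) (s k (foot j (suc d)))
    turn  : ∀ k j → R (s (suc k) j) (s k (foot j 2F)) → ¬ Cut (suc k) j →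
            (∀ j′ → ¬ R (s (suc k) (next j)) (s (suc (suc k)) j′)) →
            Move R (s (suc k) (next j)) (s k (foot j 2F))
    birth : ∀ k → R (c k) (s (suc k) 0F) → Move R (s (suc k) 0F) (s k 0F)
    sow   : ∀ {p k i} → Sow R p k i → ¬ Occupied R (suc k) i → Move R p (s (suc k) i)

  Move-edge : ∀ {R p q} → Move R p q → Edge₀ p q
  Move-edge (slide k j d _)    = token (suc d) refl
  Move-edge (turn k j _ _ _)   = token 0F (foot-turn j)
  Move-edge (birth k _)        = token 0F refl
  Move-edge (sow enter _)        = sweep λ ()
  Move-edge (sow (down i≢0 _ _) _) = sweep i≢0
  Move-edge (sow (pass _) _)     = finish (s≤s (s≤s z≤n))
  Move-edge (sow (drop _) _)     = finish (s≤s z≤n)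

  Sow-seed : ∀ {R p k i} → Sow R p k i → Seed p k
  Sow-seed enter        = inj₁ refl
  Sow-seed (down _ _ _) = inj₁ refl
  Sow-seed (pass _)     = inj₂ refl
  Sow-seed (drop _)     = inj₂ refl

  -- Every local blocking pair is a move

  module Classify {R : Relation} (I : Inv R) where
    open Inv I

    wants-< : ∀ {p q w} → Wants R p q → R p w → cost p q < cost p w
    wants-< (unmatched free) r = ⊥-elim (free _ r)
    wants-< (improves r′ lt) r rewrite uniq r r′ = lt

    wants-⊥ : ∀ {p q w} → Wants R p q → R p w → cost p w ≤ cost p q → ⊥
    wants-⊥ W r le = <-irrefl refl (<-≤-trans (wants-< W r) le)

    data Path (p q : Player) : Set where
      ll : ∀ w → Link p w → Link w q → Path p q
      lm : ∀ w → Link p w → R w q → Path p q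
      ml : ∀ w → R p w → Link w q → Path p q

    path : ∀ {p q} → Edge₀ p q → Wants R p q → Access R p q → Path p q
    path e W (inj₁ refl) = ⊥-elim (Edge₀-irrefl e)
    path e W (inj₂ (inj₁ (inj₁ l))) = ⊥-elim (Edge₀-unlinked e l)
    path e W (inj₂ (inj₁ (inj₂ r))) = ⊥-elim (wants-⊥ W r ≤-refl)
    path e W (inj₂ (inj₂ (w , inj₁ l , inj₁ l′))) = ll w l l′
    path e W (inj₂ (inj₂ (w , inj₁ l , inj₂ r))) = lm w l r
    path e W (inj₂ (inj₂ (w , inj₂ r , inj₁ l))) = ml w r l
    path e W (inj₂ (inj₂ (w , inj₂ r , inj₂ r′))) with uniq (symm r) r′
    ... | refl = ⊥-elim (Edge₀-irrefl e)

    token-edge : ∀ {k j i} → R (s (suc k) j) (s k i) → Σ (Fin 3) λ d → i ≡ foot j d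
    token-edge r with edges r
    ... | inj₁ (token d eq) = d , eq

    seed-unoccupied : ∀ {k i p} → Seed p k → Wants R (s (suc k) i) p → ¬ Occupied R (suc k) i
    seed-unoccupied {k} {i} (inj₁ refl) W (l , j , r) =
      wants-⊥ W r (≤-trans (cost-s≤10 (suc k) i l j) (m≤m+n 10 11))
    seed-unoccupied {k} {i} (inj₂ refl) W (l , j , r) =
      wants-⊥ W r (≤-trans (cost-s≤10 (suc k) i l j) (m≤m+n 10 10))

    -- Two links never join `s` players of different levels, so the path uses one matched edge.
    -- Going round forwards it gives a slide or a turn, and through `c k` a birth. A backward turn
    -- is refused by the lower player, which prefers early stages, and a backward slide by the upper
    -- one, which prefers late stages.
    classify-token : ∀ {k j i} d → i ≡ foot j d →
      Wants R (s (suc k) j) (s k i) → Wants R (s k i) (s (suc k) j) →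
      Path (s (suc k) j) (s k i) → Move R (s (suc k) j) (s k i)
    classify-token d eq W V (ll _ (fwd _ _) ())
    classify-token d eq W V (ll _ (bwd _ _) ())
    classify-token d eq W V (ll _ (sc _) ())
    classify-token d eq W V (ll _ (sy _) ())
    classify-token {k} {j} d refl W V (lm _ (fwd refl _) r) with token-edge r
    ... | d′ , eq′ with foot-shared j d d′ eq′
    ... | refl , refl = ⊥-elim (wants-⊥ V (symm r) (≤-reflexive (begin
            cost (s k (foot j 2F)) (s (suc k) (next j)) ≡⟨ cong (λ z → cost (s k z) (s (suc k) (next j))) eq′ ⟩
            cost (s k (foot (next j) 0F)) (s (suc k) (next j)) ≡⟨ cost-upper k (next j) 0F ⟩
            0 ∎) ⟨≤⟩ z≤n))
      where open ≡-Reasoning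
            _⟨≤⟩_ = ≤-trans
    classify-token {k} d refl W V (lm (s _ j) (bwd refl cut) r) with token-edge r
    ... | d′ , eq′ with foot-shared j d′ d (sym eq′)
    ... | refl , refl = subst (λ z → Move R (s (suc k) (next j)) (s k z)) (foot-turn j)
            (turn k j (subst (λ z → R (s (suc k) j) (s k z)) eq′ r) cut
              λ j′ r′ → wants-⊥ W r′ (upper j′ r′))
      where
      upper : ∀ j′ → R (s (suc k) (next j)) (s (suc (suc k)) j′) →
              cost (s (suc k) (next j)) (s (suc (suc k)) j′) ≤ cost (s (suc k) (next j)) (s k (foot (next j) 0F))
      upper j′ r′ rewrite cost-lower k (next j) 0F = cost-s≤10 (suc k) (next j) (suc (suc k)) j′
    classify-token d eq W V (lm _ (sc _) r) with edges r
    ... | inj₁ ()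
    ... | inj₂ ()
    classify-token d eq W V (lm _ (sy _) r) with edges r
    ... | inj₁ ()
    ... | inj₂ ()
    classify-token {k} {j} d eq W V (ml _ r (fwd refl _)) with token-edge r
    ... | d′ , refl = go d′ d (foot-next j d′ d (sym eq)) eq r
      where
      go : ∀ d′ d → toℕ d ≡ suc (toℕ d′) → next (foot j d′) ≡ foot j d → R (s (suc k) j) (s k (foot j d′)) →
           Move R (s (suc k) j) (s k (next (foot j d′)))
      go 0F 1F _ _ r = slide k j 0F r
      go 1F 2F _ _ r = slide k j 1F r
      go 2F 0F () _ _
      go 2F 1F () _ _
      go 2F 2F () _ _
    classify-token {k} {j} d refl W V (ml (s _ i) r (bwd eq _)) with token-edge r
    ... | d′ , refl = ⊥-elim (wants-⊥ W r (le d′ d (foot-next j d d′ eq)))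
      where
      le : ∀ d′ d → toℕ d′ ≡ suc (toℕ d) →
           cost (s (suc k) j) (s k (foot j d′)) ≤ cost (s (suc k) j) (s k (foot j d))
      le d′ d q rewrite cost-lower k j d′ | cost-lower k j d = ∸-monoʳ-≤ 10 (<⇒≤ (≤-reflexive (sym q)))
    classify-token {k} {j} d eq W V (ml _ r (cs refl)) with edges r
    ... | inj₂ (finish lt) with foot-zero j d lt eq
    ... | refl = birth k (symm r)
    classify-token d eq W V (ml _ r (ys _)) with edges r
    ... | inj₁ ()
    ... | inj₂ ()

    classify-sweep : ∀ {k i} → i ≢ 0F →
      Wants R (b k) (s (suc k) i) → Wants R (s (suc k) i) (b k) →
      Path (b k) (s (suc k) i) → Move R (b k) (s (suc k) i)
    classify-sweep i≢0 W V (ll _ by (ys refl)) = sow enter (seed-unoccupied (inj₁ refl) V)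
    -- A player matched to `c k` at cost 20 does not return to `b k` at cost 21.
    classify-sweep i≢0 W V (lm _ bc r) = ⊥-elim (wants-⊥ V (symm r) (m≤m+n 20 1))
    classify-sweep i≢0 W V (lm _ by r) with edges r
    ... | inj₁ ()
    ... | inj₂ ()
    classify-sweep {k} i≢0 W V (ml (s _ i) r l) with edges r
    classify-sweep {k} i≢0 W V (ml (s _ i) r (fwd {i′ = i′} eq _)) | inj₁ (sweep _) with i ≟ᶠ 4F
    ... | yes refl = contradiction eq i≢0
    ... | no i≢4   = ⊥-elim (wants-⊥ W r (<⇒≤ (≤-reflexive (sym (next-cases i i′ eq i≢4)))))
    classify-sweep {k} {i′} i≢0 W V (ml (s _ i) r (bwd eq _)) | inj₁ (sweep n0) =
      sow (down i≢0 (λ { refl → n0 eq }) (subst (λ z → R (b k) (s (suc k) z)) eq r))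
          (seed-unoccupied (inj₁ refl) V)
    classify-sweep i≢0 W V (ml (b x) r l) with edges r
    ... | inj₁ ()
    ... | inj₂ ()
    classify-sweep i≢0 W V (ml (c x) r l) with edges r
    ... | inj₁ ()
    ... | inj₂ ()
    classify-sweep i≢0 W V (ml (y x) r l) with edges r
    ... | inj₁ ()
    ... | inj₂ ()

    classify-finish : ∀ {k i} → toℕ i < 2 →
      Wants R (c k) (s (suc k) i) → Wants R (s (suc k) i) (c k) →
      Path (c k) (s (suc k) i) → Move R (c k) (s (suc k) i)
    classify-finish lt W V (ll _ cb ())
    classify-finish lt W V (ll _ (cs _) ())
    classify-finish lt W V (lm _ cb r) with edges r
    classify-finish {i = 0F} lt W V (lm _ cb r) | inj₁ (sweep n0) = ⊥-elim (n0 refl)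
    classify-finish {i = 1F} lt W V (lm _ cb r) | inj₁ (sweep _) = sow (pass r) (seed-unoccupied (inj₂ refl) V)
    classify-finish {i = suc (suc i)} (s≤s (s≤s ())) W V (lm _ cb r) | _
    classify-finish {k} {i} lt W V (lm _ (cs {i = i′} _) r) =
      ⊥-elim (seed-unoccupied (inj₂ refl) V (k , i′ , symm r))
    classify-finish lt W V (ml _ r l) with edges r
    classify-finish {i = 0F} lt W V (ml (s _ 1F) r l) | inj₁ (finish _) = sow (drop r) (seed-unoccupied (inj₂ refl) V)
    classify-finish {i = 0F} lt W V (ml (s _ 0F) r l) | inj₁ (finish _) = ⊥-elim (wants-⊥ W r ≤-refl)
    classify-finish {i = 1F} lt W V (ml (s _ 1F) r l) | inj₁ (finish _) = ⊥-elim (wants-⊥ W r ≤-refl)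
    classify-finish {i = 1F} lt W V (ml (s _ 0F) r l) | inj₁ (finish _) = ⊥-elim (wants-⊥ W r z≤n)
    classify-finish {i = suc (suc _)} (s≤s (s≤s ())) W V (ml _ r l) | inj₁ (finish _)
    classify-finish {i = i} lt W V (ml (s _ (suc (suc _))) r l) | inj₁ (finish (s≤s (s≤s ())))

    classify : ∀ {p q} → Edge₀ p q → Access R p q → Wants R p q → Wants R q p → Move R p q
    classify e@(token d eq) A W V = classify-token d eq W V (path e W A)
    classify e@(sweep i≢0) A W V  = classify-sweep i≢0 W V (path e W A)
    classify e@(finish lt) A W V  = classify-finish lt W V (path e W A)

  -- Preservation of the invariant

  Away : Player → Player → Player → Set
  Away p q x = x ≢ p × x ≢ q

  record Step (R R′ : Relation) (p q : Player) : Set where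
      field
        new  : R′ p q
        new′ : R′ q p
        kept : ∀ {x y} → R x y → Away p q x → Away p q y → R′ x y
        from : ∀ {x y} → R′ x y →
               (x ≡ p × y ≡ q ⊎ x ≡ q × y ≡ p) ⊎ (R x y × Away p q x × Away p q y)

  module Preservation {R R′ : Relation} (I : Inv R) {p q : Player} (m : Move R p q) (S : Step R R′ p q) where
      open Inv I
      open Step S

      p≢q : p ≢ q
      p≢q refl = Edge₀-irrefl (Move-edge m)

      -- Slides and turns replace the token they start from, so only a birth could add a second one;
      -- but it requires a seed at 0, and by `seed` no occupied place lies below 0.
      one-new : ∀ {k j j′ i i′} → (s (suc k) j ≡ p × s k i ≡ q ⊎ s (suc k) j ≡ q × s k i ≡ p) →
                R (s (suc k) j′) (s k i′) → s k i′ ≢ q → j ≡ j′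
      one-new = go m
        where
        go : ∀ {p q} → Move R p q → ∀ {k j j′ i i′} →
             (s (suc k) j ≡ p × s k i ≡ q ⊎ s (suc k) j ≡ q × s k i ≡ p) →
             R (s (suc k) j′) (s k i′) → s k i′ ≢ q → j ≡ j′
        go (slide k j d r) (inj₁ (refl , refl)) r′ _ = one r r′
        go (turn k j r _ _) (inj₁ (refl , refl)) r′ ne with one r r′
        ... | refl = contradiction (uniq r′ r) ne
        go (birth k r) {i′ = i′} (inj₁ (refl , refl)) r′ _ with seed (inj₂ refl) r (k , i′ , r′)
        ... | ()
        go (slide _ _ _ _) (inj₂ (refl , ())) _ _
        go (turn _ _ _ _ _) (inj₂ (refl , ())) _ _
        go (birth _ _) (inj₂ (refl , ())) _ _
        go (sow σ _) (inj₁ (refl , _)) _ _ with Sow-seed σ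
        ... | inj₁ ()
        ... | inj₂ ()
        go (sow σ _) (inj₂ (_ , refl)) _ _ with Sow-seed σ
        ... | inj₁ ()
        ... | inj₂ ()

      -- A token end that was below the seed advances by one place at most, and without wrapping
      -- around. Reaching the seed's place would have displaced the seed, which `Away` excludes. A
      -- token born at 0 is below any surviving seed for the same reason.
      occupied-new : ∀ {K j l i x h} → (s (suc K) j ≡ p × s l i ≡ q ⊎ s (suc K) j ≡ q × s l i ≡ p) →
                     Seed x K → R x (s (suc K) h) → Away p q (s (suc K) h) → toℕ j < toℕ h
      occupied-new = go m
        where
        go : ∀ {p q} → Move R p q → ∀ {K j l i x h} →
             (s (suc K) j ≡ p × s l i ≡ q ⊎ s (suc K) j ≡ q × s l i ≡ p) →
             Seed x K → R x (s (suc K) h) → Away p q (s (suc K) h) → toℕ j < toℕ h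
        go (slide k j d r) (inj₁ (refl , _)) σ u _ = seed σ u (k , foot j (inject₁ d) , r)
        go (slide (suc k) j d r) {h = h} (inj₂ (refl , _)) σ u (_ , ne) rewrite foot-slide j d =
          next-< (foot j (inject₁ d)) h (seed σ u (suc (suc k) , j , symm r)) (λ { refl → ne refl })
        go (turn k j r _ _) {h = h} (inj₁ (refl , _)) σ u (ne , _) =
          next-< j h (seed σ u (k , foot j 2F , r)) (λ { refl → ne refl })
        go (turn k j r _ _) (inj₂ (refl , _)) σ u _ = seed σ u (suc k , j , symm r)
        go (birth k r) (inj₁ (refl , _)) σ u (ne , _) = ≢0⇒0< _ λ { refl → ne refl }
        go (birth (suc k) r) (inj₂ (refl , _)) σ u (_ , ne) = ≢0⇒0< _ λ { refl → ne refl }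
        go (sow τ _) (inj₁ (refl , _)) _ _ _ with Sow-seed τ
        ... | inj₁ ()
        ... | inj₂ ()
        go (sow τ _) (inj₂ (_ , refl)) _ _ _ with Sow-seed τ
        ... | inj₁ ()
        ... | inj₂ ()

      -- A seed descends by single places and only onto unoccupied ones, so it cannot pass a token;
      -- it enters at 4, above every other place.
      sow-bound : ∀ {x k i j} → Sow R x k i → ¬ Occupied R (suc k) i → Occupied R (suc k) j → toℕ j < toℕ i
      sow-bound {i = i} {j} σ free o = go σ
        where
        j≢i : j ≢ i
        j≢i refl = free o
        go : Sow R _ _ i → toℕ j < toℕ i
        go enter         = below-four j j≢i
        go (down _ ne r) = below-next i j ne (seed (inj₁ refl) r o) j≢i
        go (pass r)      = seed (inj₁ refl) r o
        go (drop r)      = below-next 0F j (λ ()) (seed (inj₂ refl) r o) j≢i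

      seed-new : ∀ {x k i j} → Seed x k → (x ≡ p × s (suc k) i ≡ q ⊎ x ≡ q × s (suc k) i ≡ p) →
                 Occupied R (suc k) j → toℕ j < toℕ i
      seed-new = go m
        where
        go : ∀ {p q} → Move R p q → ∀ {x k i j} → Seed x k →
             (x ≡ p × s (suc k) i ≡ q ⊎ x ≡ q × s (suc k) i ≡ p) →
             Occupied R (suc k) j → toℕ j < toℕ i
        go (slide _ _ _ _) (inj₁ refl) (inj₁ (() , _))
        go (slide _ _ _ _) (inj₁ refl) (inj₂ (() , _))
        go (slide _ _ _ _) (inj₂ refl) (inj₁ (() , _))
        go (slide _ _ _ _) (inj₂ refl) (inj₂ (() , _))
        go (turn _ _ _ _ _) (inj₁ refl) (inj₁ (() , _))
        go (turn _ _ _ _ _) (inj₁ refl) (inj₂ (() , _))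
        go (turn _ _ _ _ _) (inj₂ refl) (inj₁ (() , _))
        go (turn _ _ _ _ _) (inj₂ refl) (inj₂ (() , _))
        go (birth _ _) (inj₁ refl) (inj₁ (() , _))
        go (birth _ _) (inj₁ refl) (inj₂ (() , _))
        go (birth _ _) (inj₂ refl) (inj₁ (() , _))
        go (birth _ _) (inj₂ refl) (inj₂ (() , _))
        go (sow τ free) _ (inj₁ (refl , refl)) o = sow-bound τ free o
        go (sow τ free) (inj₁ refl) (inj₂ (() , _)) _
        go (sow τ free) (inj₂ refl) (inj₂ (() , _)) _

      new-away : ∀ {x y} → (x ≡ p × y ≡ q ⊎ x ≡ q × y ≡ p) → Away p q x → ⊥
      new-away (inj₁ (e , _)) (ne , _) = ne e
      new-away (inj₂ (e , _)) (_ , ne) = ne e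

      seed-token-⊥ : ∀ {x k i K j l h} → Seed x k →
        (x ≡ p × s (suc k) i ≡ q ⊎ x ≡ q × s (suc k) i ≡ p) →
        (s K j ≡ p × s l h ≡ q ⊎ s K j ≡ q × s l h ≡ p) → ⊥
      seed-token-⊥ σ (inj₁ (refl , refl)) (inj₁ (refl , _)) = [ (λ ()) , (λ ()) ]′ σ
      seed-token-⊥ σ (inj₁ (refl , refl)) (inj₂ (_ , refl)) = [ (λ ()) , (λ ()) ]′ σ
      seed-token-⊥ σ (inj₂ (refl , refl)) (inj₁ (_ , refl)) = [ (λ ()) , (λ ()) ]′ σ
      seed-token-⊥ σ (inj₂ (refl , refl)) (inj₂ (refl , _)) = [ (λ ()) , (λ ()) ]′ σ

      preserved : Inv R′
      Inv.symm preserved r with from r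
      ... | inj₁ (inj₁ (refl , refl)) = new′
      ... | inj₁ (inj₂ (refl , refl)) = new
      ... | inj₂ (r′ , a , a′) = kept (symm r′) a′ a
      Inv.edges preserved r with from r
      ... | inj₁ (inj₁ (refl , refl)) = inj₁ (Move-edge m)
      ... | inj₁ (inj₂ (refl , refl)) = inj₂ (Move-edge m)
      ... | inj₂ (r′ , _) = edges r′
      Inv.uniq preserved r r′ with from r | from r′
      ... | inj₁ (inj₁ (refl , refl)) | inj₁ (inj₁ (_ , refl)) = refl
      ... | inj₁ (inj₁ (refl , refl)) | inj₁ (inj₂ (e , _)) = contradiction e p≢q
      ... | inj₁ (inj₂ (refl , refl)) | inj₁ (inj₁ (e , _)) = contradiction (sym e) p≢q
      ... | inj₁ (inj₂ (refl , refl)) | inj₁ (inj₂ (_ , refl)) = refl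
      ... | inj₁ e | inj₂ (_ , a , _) = ⊥-elim (new-away e a)
      ... | inj₂ (_ , a , _) | inj₁ e = ⊥-elim (new-away e a)
      ... | inj₂ (u , _) | inj₂ (u′ , _) = uniq u u′
      Inv.one preserved r r′ with from r | from r′
      ... | inj₁ e | inj₂ (u , _ , _ , ne) = one-new e u ne
      ... | inj₂ (u , _ , _ , ne) | inj₁ e = sym (one-new e u ne)
      ... | inj₂ (u , _) | inj₂ (u′ , _) = one u u′
      ... | inj₁ (inj₁ (refl , refl)) | inj₁ (inj₁ (refl , _)) = refl
      ... | inj₁ (inj₁ (refl , refl)) | inj₁ (inj₂ (() , _))
      ... | inj₁ (inj₂ (refl , refl)) | inj₁ (inj₁ (() , _))
      ... | inj₁ (inj₂ (refl , refl)) | inj₁ (inj₂ (refl , _)) = refl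
      Inv.seed preserved σ r (l , h , o) with from r | from o
      ... | inj₁ e | inj₁ e′ = ⊥-elim (seed-token-⊥ σ e e′)
      ... | inj₁ e | inj₂ (u , _) = seed-new σ e (l , h , u)
      ... | inj₂ (u , _ , a) | inj₁ e = occupied-new e σ u a
      ... | inj₂ (u , _) | inj₂ (v , _) = seed σ u (l , h , v)

-- Positions are lifted from ℤ/5 to ℕ: a token at (residue a , d) also holds residue (wind a d) one level below.
residue : ℕ → Fin 5
residue zero    = 0F
residue (suc a) = next (residue a)

wind : ℕ → Fin 3 → ℕ
wind a d = a + a + toℕ d

double-next : ∀ i → double (next i) ≡ next (next (double i))
double-next = from-yes (all? λ i → double (next i) ≟ᶠ next (next (double i)))

residue-double : ∀ a → double (residue a) ≡ residue (a + a)
residue-double zero = refl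
residue-double (suc a) rewrite +-suc a a =
  trans (double-next (residue a)) (cong (λ z → next (next z)) (residue-double a))

residue-wind : ∀ a d → foot (residue a) d ≡ residue (wind a d)
residue-wind a 0F rewrite +-identityʳ (a + a) = residue-double a
residue-wind a 1F rewrite +-comm (a + a) 1 = cong next (residue-double a)
residue-wind a 2F rewrite +-comm (a + a) 2 = cong (λ z → next (next z)) (residue-double a)

next⁴ : ∀ i → next (next i) ≢ i × next (next (next i)) ≢ i × next (next (next (next i))) ≢ i
next⁴ = from-yes (all? λ i → ¬? (next (next i) ≟ᶠ i) ×-dec (¬? (next (next (next i)) ≟ᶠ i)
  ×-dec ¬? (next (next (next (next i))) ≟ᶠ i)))

next⁵ : ∀ i → next (next (next (next (next i)))) ≡ i
next⁵ = from-yes (all? λ i → next (next (next (next (next i)))) ≟ᶠ i)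

residue-window : ∀ {a a′} → a < a′ → a′ < a + 5 → residue a′ ≢ residue a
residue-window {a} {a′} lt lt′ = subst (λ z → residue z ≢ residue a) (m∸n+n≡m (<⇒≤ lt))
  (go (a′ ∸ a) (m<n⇒0<n∸m lt) (m<n+o⇒m∸n<o a′ a lt′))
  where
  go : ∀ e → 0 < e → e < 5 → residue (e + a) ≢ residue a
  go 1 _ _ = next-≢ _
  go 2 _ _ = proj₁ (next⁴ _)
  go 3 _ _ = proj₁ (proj₂ (next⁴ _))
  go 4 _ _ = proj₂ (proj₂ (next⁴ _))
  go (suc (suc (suc (suc (suc _))))) _ (s≤s (s≤s (s≤s (s≤s (s≤s ())))))

next-reaches : ∀ i j → j ≢ i → j ≡ next i ⊎ j ≡ next (next i) ⊎ j ≡ next (next (next i)) ⊎ j ≡ next (next (next (next i)))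
next-reaches = from-yes (all? λ i → all? λ j → ¬? (j ≟ᶠ i) →-dec
  ((j ≟ᶠ next i) ⊎-dec ((j ≟ᶠ next (next i)) ⊎-dec ((j ≟ᶠ next (next (next i)))
   ⊎-dec (j ≟ᶠ next (next (next (next i))))))))
  where open import Relation.Nullary.Decidable using (_⊎-dec_)

lift-residue : ∀ ρ j → j ≢ residue ρ → Σ ℕ λ a → ρ < a × a < ρ + 5 × residue a ≡ j
lift-residue ρ j ne = go (next-reaches (residue ρ) j ne)
  where
  pick : ∀ e → 0 < e → e < 5 → residue (e + ρ) ≡ j → Σ ℕ λ a → ρ < a × a < ρ + 5 × residue a ≡ j
  pick e 0<e e<5 eq = e + ρ , +-monoˡ-≤ ρ 0<e , subst (e + ρ <_) (+-comm 5 ρ) (+-monoˡ-< ρ e<5) , eq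
  go : _ → Σ ℕ λ a → ρ < a × a < ρ + 5 × residue a ≡ j
  go (inj₁ eq) = pick 1 (s≤s z≤n) (m≤m+n 2 3) (sym eq)
  go (inj₂ (inj₁ eq)) = pick 2 (s≤s z≤n) (m≤m+n 3 2) (sym eq)
  go (inj₂ (inj₂ (inj₁ eq))) = pick 3 (s≤s z≤n) (m≤m+n 4 1) (sym eq)
  go (inj₂ (inj₂ (inj₂ eq))) = pick 4 (s≤s z≤n) ≤-refl (sym eq)

-- Chains of tokens and their lifted positions

module Construction (h : ℕ) where

  open Network (suc (suc h))

  s-level : ∀ {k k′ i i′} → s k i ≡ s k′ i′ → k ≡ k′
  s-level refl = refl

  s-index : ∀ {k k′ i i′} → s k i ≡ s k′ i′ → i ≡ i′
  s-index refl = refl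

  levels-apart : ∀ {k i i′} → s (suc (suc k)) i ≢ s k i′
  levels-apart ()

  Token : Relation → ℕ → Fin 5 → Fin 5 → Set
  Token R k j i = R (s (suc k) j) (s k i)

  Dead : Relation → ℕ → Set
  Dead R k = ∀ j i → ¬ Token R k j i

  -- Token 0 is left out because the absence of a token is incompatible with stability only through
  -- the token below, which then becomes free to move (see `can-move`).
  DeadUpTo : Relation → ℕ → Set
  DeadUpTo R m = Σ ℕ λ k → 0 < k × k ≤ m × Dead R k

  -- Chain R m ρ out: lifted positions of the tokens m, ..., 1, where ρ is the lifted position of token m + 1
  -- on level m + 1 and out that of token 1 on level 1; each token is less than one round ahead of the next.
  data Chain (R : Relation) : ℕ → ℕ → ℕ → Set where
    []  : ∀ {ρ} → Chain R 0 ρ ρ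
    hop : ∀ {m ρ out} a d → Token R (suc m) (residue a) (foot (residue a) d) →
          ρ < a → a < ρ + 5 → Chain R m (wind a d) out → Chain R (suc m) ρ out

  Above : Relation → ℕ → ℕ → Set
  Above R m ρ = Σ (Fin 5) λ j → Token R (suc m) j (residue ρ)

  hop-above : ∀ {R m} a d → Token R (suc m) (residue a) (foot (residue a) d) → Above R m (wind a d)
  hop-above {R} {m} a d τ = residue a , subst (Token R (suc m) (residue a)) (residue-wind a d) τ

  chain-map : ∀ {R R′ : Relation} {m ρ out} →
    (∀ {k j i} → 0 < k → k ≤ m → Token R k j i → Token R′ k j i) → Chain R m ρ out → Chain R′ m ρ out
  chain-map f [] = []
  chain-map f (hop a d τ l u ch) = hop a d (f (s≤s z≤n) ≤-refl τ) l u
    (chain-map (λ 0<k k≤m → f 0<k (m≤n⇒m≤1+n k≤m)) ch)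

  private
    double-step : ∀ x y → x * (2 * y) ≡ 2 * x * y
    double-step = solve-∀

  -- From `a ≥ ρ + 1` follows `wind a d ≥ 2 (ρ + 1)`, so `ρ + 2` at least doubles with every hop.
  chain-lower : ∀ {R m ρ out} → Chain R m ρ out → 2 ^ m * (ρ + 2) ≤ out + 2
  chain-lower [] = ≤-reflexive (*-identityˡ _)
  chain-lower {m = suc m} {ρ} {out} (hop a d _ l _ ch) = begin
    2 ^ suc m * (ρ + 2)       ≡⟨ sym (double-step (2 ^ m) (ρ + 2)) ⟩
    2 ^ m * (2 * (ρ + 2))     ≡⟨ cong (2 ^ m *_) (lemma ρ) ⟩
    2 ^ m * (suc ρ + suc ρ + 2) ≤⟨ *-monoʳ-≤ (2 ^ m) (+-monoˡ-≤ 2 (≤-trans (+-mono-≤ l l) (m≤m+n (a + a) (toℕ d)))) ⟩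
    2 ^ m * (wind a d + 2)    ≤⟨ chain-lower ch ⟩
    out + 2 ∎
    where
    open ≤-Reasoning
    lemma : ∀ ρ → 2 * (ρ + 2) ≡ suc ρ + suc ρ + 2
    lemma = solve-∀

  -- The place `residue ρ` is taken by the token above, so the next token, if alive, has a
  -- representative `a` among the four positions after `ρ`. Then `wind a d ≤ 2 (ρ + 4) + 2`, and
  -- `ρ + 10` at most doubles with every hop.
  chain-build : ∀ {R} → Inv R → (∀ k → (Σ (Fin 5) λ j → Σ (Fin 5) λ i → Token R k j i) ⊎ Dead R k) →
    ∀ m ρ → Above R m ρ → (Σ ℕ λ out → out + 10 ≤ 2 ^ m * (ρ + 10) × Chain R m ρ out) ⊎ DeadUpTo R m
  chain-build I alive? zero ρ _ = inj₁ (ρ , ≤-reflexive (sym (*-identityˡ _)) , [])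
  chain-build {R} I alive? (suc m) ρ (j′ , above) with alive? (suc m)
  ... | inj₂ dead = inj₂ (suc m , s≤s z≤n , ≤-refl , dead)
  ... | inj₁ (j , i , τ) with Inv.edges I τ
  ... | inj₁ (token d refl) with lift-residue ρ j (λ { refl → levels-apart (Inv.uniq I (Inv.symm I above) τ) })
  ... | a , l , u , refl with chain-build I alive? m (wind a d) (hop-above {R} a d τ)
  ... | inj₂ (k , 0<k , k≤m , dead) = inj₂ (k , 0<k , m≤n⇒m≤1+n k≤m , dead)
  ... | inj₁ (out , bound , ch) = inj₁ (out , bound′ , hop a d τ l u ch)
    where
    open ≤-Reasoning
    u′ : a ≤ ρ + 4
    u′ = ≤-pred (subst (a <_) (+-suc ρ 4) u)
    lemma : ∀ ρ → ρ + 4 + (ρ + 4) + 2 + 10 ≡ 2 * (ρ + 10)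
    lemma = solve-∀
    bound′ : out + 10 ≤ 2 ^ suc m * (ρ + 10)
    bound′ = begin
      out + 10 ≤⟨ bound ⟩
      2 ^ m * (wind a d + 10) ≤⟨ *-monoʳ-≤ (2 ^ m) (+-monoˡ-≤ 10 (+-mono-≤ (+-mono-≤ u′ u′) (toℕ≤pred[n] d))) ⟩
      2 ^ m * (ρ + 4 + (ρ + 4) + 2 + 10) ≡⟨ cong (2 ^ m *_) (lemma ρ) ⟩
      2 ^ m * (2 * (ρ + 10)) ≡⟨ double-step (2 ^ m) (ρ + 10) ⟩
      2 ^ suc m * (ρ + 10) ∎

  -- The levels are 0, ..., h + 2, so that h + 1 is the top token.
  data Alive (R : Relation) (out : ℕ) : Set where
    alive : ∀ a d → Token R (suc h) (residue a) (foot (residue a) d) → a < 5 →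
            Chain R h (wind a d) out → Alive R out

  chain-token : ∀ {R m ρ out} → Chain R m ρ out → ∀ {k} → 0 < k → k ≤ m →
                Σ (Fin 5) λ j → Σ (Fin 5) λ i → Token R k j i
  chain-token (hop {m} a d τ _ _ ch) {k} 0<k k≤m with k ≟ suc m
  ... | yes refl = _ , _ , τ
  ... | no k≢m   = chain-token ch 0<k (≤-pred (≤∧≢⇒< k≤m k≢m))
  chain-token [] 0<k k≤0 = contradiction (≤-trans 0<k k≤0) λ ()

  alive-token : ∀ {R out} → Alive R out → ∀ {k} → 0 < k → k ≤ suc h → Σ (Fin 5) λ j → Σ (Fin 5) λ i → Token R k j i
  alive-token (alive a d τ _ ch) {k} 0<k k≤h with k ≟ suc h
  ... | yes refl = _ , _ , τ
  ... | no k≢m   = chain-token ch 0<k (≤-pred (≤∧≢⇒< k≤h k≢m))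

  -- Slides and turns acting on chains

  module Advance {R R′ : Relation} (I : Inv R) where
    open Inv I

    Result : ℕ → ℕ → ℕ → Set
    Result m ρ out = (Σ ℕ λ out′ → out′ ≤ suc out × Chain R′ m ρ out′) ⊎ DeadUpTo R′ m

    deepen : ∀ {m ρ out a d} → Token R′ (suc m) (residue a) (foot (residue a) d) → ρ < a → a < ρ + 5 →
             Result m (wind a d) out → Result (suc m) ρ out
    deepen {a = a} {d} τ l u (inj₁ (o , le , ch)) = inj₁ (o , le , hop a d τ l u ch)
    deepen τ l u (inj₂ (k , 0<k , k≤m , dead)) = inj₂ (k , 0<k , m≤n⇒m≤1+n k≤m , dead)

    module Slide {k j} {d : Fin 2} (r : Token R k j (foot j (inject₁ d)))
                 (S : Step R R′ (s (suc k) j) (s k (foot j (suc d)))) where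
      open Step S

      keep : ∀ {l i i′} → l ≢ k → s (suc l) i ≢ s k (foot j (suc d)) → Token R l i i′ → Token R′ l i i′
      keep l≢k ne τ = kept τ ((λ { refl → l≢k refl }) , ne)
        ((λ { refl → levels-apart (uniq (symm τ) r) }) , λ { refl → l≢k refl })

      -- The lower end of token `k` goes from `ρ` to `suc ρ`. If the next token stands there, it is
      -- destroyed, and by `one` there is no second copy; otherwise it is still strictly ahead and
      -- the rest of the chain is unchanged. Only for token 1, where the rest is empty, does `out`
      -- itself grow.
      shift : ∀ {m ρ out} → k ≡ suc m → foot j (suc d) ≡ residue (suc ρ) →
              Chain R m ρ out → Result m (suc ρ) out
      shift refl q≡ [] = inj₁ (_ , ≤-refl , [])
      shift {ρ = ρ} refl q≡ (hop {m} a d′ τ l u ch) with a ≟ suc ρ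
      ... | yes refl = inj₂ (suc m , s≤s z≤n , ≤-refl , dead)
        where
        dead : Dead R′ (suc m)
        dead i i′ τ′ with from τ′
        ... | inj₁ (inj₁ (() , _))
        ... | inj₁ (inj₂ (_ , ()))
        ... | inj₂ (τ″ , (_ , ne) , _) = ne (cong (s (suc (suc m))) (trans (one τ″ τ) (sym q≡)))
      ... | no a≢ = inj₁ (_ , n≤1+n _ , hop a d′ (keep (λ ()) apart τ) l′ (m<n⇒m<1+n u)
                      (chain-map (λ {l} _ l≤m → keep (λ { refl → <-irrefl refl (≤-trans (n≤1+n _) l≤m) })
                                   λ e → <-irrefl (suc-injective (s-level e)) (s≤s l≤m)) ch))
        where
        l′ : suc ρ < a
        l′ = ≤∧≢⇒< l (≢-sym a≢)
        apart : s (suc (suc m)) (residue a) ≢ s (suc (suc m)) (foot j (suc d))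
        apart e with trans (s-index e) q≡
        ... | eq = residue-window l′ (m<n⇒m<1+n u) eq

      slid : ∀ {a d′} → residue a ≡ j → foot (residue a) d′ ≡ foot j (inject₁ d) →
             Token R′ k (residue a) (foot (residue a) (suc d)) × wind a (suc d) ≡ suc (wind a d′) ×
             foot j (suc d) ≡ residue (suc (wind a d′))
      slid {a} {d′} refl eq with foot-injective j d′ (inject₁ d) eq
      ... | refl = new , w , trans (residue-wind a (suc d)) (cong residue w)
        where
        w : wind a (suc d) ≡ suc (wind a (inject₁ d))
        w = trans (+-suc (a + a) (toℕ d)) (cong (λ z → suc (a + a + z)) (sym (toℕ-inject₁ d)))

      within : ∀ {m ρ out} → 0 < k → k ≤ m → Chain R m ρ out → Result m ρ out
      within 0<k k≤0 [] = contradiction (≤-trans 0<k k≤0) λ ()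
      within {ρ = ρ} {out} 0<k k≤m (hop {m} a d′ τ l u ch) with k ≟ suc m
      ... | no k≢ = deepen (keep (≢-sym k≢) (λ e → <-irrefl (sym (s-level e)) (s≤s k≤m)) τ) l u
                      (within 0<k (≤-pred (≤∧≢⇒< k≤m k≢)) ch)
      ... | yes refl with one τ r
      ... | a≡j with slid {a} {d′} a≡j (s-index (uniq (subst (λ z → R (s (suc k) z) (s k (foot (residue a) d′))) a≡j τ) r))
      ... | τ′ , w , q≡ = deepen τ′ l u (subst (λ z → Result m z out) (sym w) (shift refl q≡ ch))

      top : ∀ {out} → 0 < k → k ≤ suc h → Alive R out →
            (Σ ℕ λ out′ → out′ ≤ suc out × Alive R′ out′) ⊎ DeadUpTo R′ (suc h)
      top {out} 0<k k≤h (alive a d′ τ a<5 ch) with k ≟ suc h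
      ... | no k≢ = wrap (within 0<k (≤-pred (≤∧≢⇒< k≤h k≢)) ch)
        where
        wrap : Result h (wind a d′) out → _
        wrap (inj₁ (o , le , ch′)) = inj₁ (o , le , alive a d′ (keep (≢-sym k≢) (λ e → <-irrefl (sym (s-level e)) (s≤s k≤h)) τ) a<5 ch′)
        wrap (inj₂ (k , 0<k , k≤m , dead)) = inj₂ (k , 0<k , m≤n⇒m≤1+n k≤m , dead)
      ... | yes refl with one τ r
      ... | a≡j with slid {a} {d′} a≡j (s-index (uniq (subst (λ z → R (s (suc k) z) (s k (foot (residue a) d′))) a≡j τ) r))
      ... | τ′ , w , q≡ = wrap (subst (λ z → Result h z out) (sym w) (shift refl q≡ ch))
        where
        wrap : Result h (wind a (suc d)) out → _
        wrap (inj₁ (o , le , ch′)) = inj₁ (o , le , alive a (suc d) τ′ a<5 ch′)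
        wrap (inj₂ (k , 0<k , k≤m , dead)) = inj₂ (k , 0<k , m≤n⇒m≤1+n k≤m , dead)

  module Turn {R R′ : Relation} (I : Inv R) {k j} (r : Token R k j (foot j 2F))
              (free : ∀ j′ → ¬ R (s (suc k) (next j)) (s (suc (suc k)) j′))
              (S : Step R R′ (s (suc k) (next j)) (s k (foot j 2F))) where
    open Inv I
    open Step S

    keep : ∀ {l i i′} → l ≢ k → Token R l i i′ → Token R′ l i i′
    keep l≢k τ = kept τ
      ((λ { refl → l≢k refl }) , λ { refl → levels-apart (uniq (symm r) τ) })
      ((λ { refl → free _ (symm τ) }) , λ { refl → l≢k refl })

    turned : ∀ {m a d} → k ≡ m → Token R m (residue a) (foot (residue a) d) →
             Token R′ m (residue (suc a)) (foot (residue (suc a)) 0F) × wind (suc a) 0F ≡ wind a d × residue a ≡ j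
    turned {m} {a} {d} refl τ with one τ r
    ... | refl with foot-injective j d 2F (s-index (uniq τ r))
    ... | refl = subst (Token R′ m (next j)) (foot-turn j) new , w , refl
      where
      w : wind (suc a) 0F ≡ wind a 2F
      w = trans (+-identityʳ _) (trans (cong suc (+-suc a a)) (+-comm 2 (a + a)))

    within : ∀ {m ρ out} → 0 < k → k ≤ m → Above R m ρ → Chain R m ρ out → Chain R′ m ρ out
    within 0<k k≤0 _ [] = contradiction (≤-trans 0<k k≤0) λ ()
    within {ρ = ρ} {out} 0<k k≤m (j′ , above) (hop {m} a d τ l u ch) with k ≟ suc m
    ... | no k≢ = hop a d (keep (≢-sym k≢) τ) l u
                    (within 0<k (≤-pred (≤∧≢⇒< k≤m k≢)) (hop-above {R} a d τ) ch)
    ... | yes k≡ with turned k≡ τ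
    ... | τ′ , w , a≡j = hop (suc a) 0F τ′ (m<n⇒m<1+n l) (≤∧≢⇒< u bump)
            (subst (λ z → Chain R′ m z out) (sym w)
              (chain-map (λ {l} _ l≤m → keep λ { refl → <-irrefl refl (subst (_≤ m) k≡ l≤m) }) ch))
      where
      -- Being a full round ahead would mean turning onto the player held by the token above, which
      -- `free` forbids.
      bump : suc a ≢ ρ + 5
      bump e = free j′ (symm (subst₂ (λ x i → R (s (suc (suc x)) j′) (s (suc x) i)) (sym k≡) eq above))
        where
        eq : residue ρ ≡ next j
        eq = trans (sym (next⁵ _)) (trans (cong residue (trans (+-comm 5 ρ) (sym e))) (cong next a≡j))

    -- For the top token the missing link plays the part of a token above: `a = 4` cannot be left,
    -- so `a < 5` persists. A turn leaves `out` unchanged, since `wind (suc a) 0F` equals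
    -- `wind a 2F`.
    top : ∀ {out} → ¬ Cut (suc k) j → 0 < k → k ≤ suc h → Alive R out → Alive R′ out
    top {out} cut 0<k k≤h (alive a d τ a<5 ch) with k ≟ suc h
    ... | no k≢ = alive a d (keep (≢-sym k≢) τ) a<5
                    (within 0<k (≤-pred (≤∧≢⇒< k≤h k≢)) (hop-above {R} a d τ) ch)
    ... | yes k≡ with turned k≡ τ
    ... | τ′ , w , a≡j = alive (suc a) 0F τ′ (≤∧≢⇒< a<5 λ { refl → cut (cong suc k≡ , sym a≡j) })
            (subst (λ z → Chain R′ h z out) (sym w)
              (chain-map (λ {l} _ l≤m → keep λ { refl → <-irrefl refl (subst (_≤ h) k≡ l≤m) }) ch))

  alive-map : ∀ {R R′ : Relation} {out} → (∀ {k j i} → 0 < k → Token R k j i → Token R′ k j i) →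
              Alive R out → Alive R′ out
  alive-map f (alive a d τ a<5 ch) = alive a d (f (s≤s z≤n) τ) a<5 (chain-map (λ 0<k _ → f 0<k) ch)

  -- Counting the steps of token 1

  Present : Player → Set
  Present (s k _) = k ≤ suc (suc h)
  Present (b k)   = k ≤ suc (suc h)
  Present (c k)   = k ≤ suc (suc h)
  Present (y k)   = k ≤ suc (suc h)

  -- 2 ^ h * 10 - 10 bounds out when the top token has just been created, see chain-build with ρ = 0.
  data Progress (R : Relation) (t : ℕ) : Set where
    dead : DeadUpTo R (suc h) → Progress R t
    live : ∀ {out} → Alive R out → out + 10 ≤ t + 2 ^ h * 10 → Progress R t

  Bounded : Relation → Set
  Bounded R = ∀ {k i q} → R (s k i) q → k ≤ suc (suc h)

  TokenDecidable : Relation → Set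
  TokenDecidable R = ∀ k → (Σ (Fin 5) λ j → Σ (Fin 5) λ i → Token R k j i) ⊎ Dead R k

  sown : ∀ {R R′ : Relation} → Inv R → ∀ {x l i} → Seed x l → ¬ Occupied R (suc l) i → Step R R′ x (s (suc l) i) →
         ∀ {k j i′} → Token R k j i′ → Token R′ k j i′
  sown {R} I {x} {l} {i} σ free S τ = Step.kept S τ (away τ) (away (Inv.symm I τ))
    where
    away : ∀ {k j k′ j′} → R (s k j) (s k′ j′) → Away x (s (suc l) i) (s k j)
    away u = (λ { refl → [ (λ ()) , (λ ()) ]′ σ }) , λ { refl → free (_ , _ , u) }

  dead-kept : ∀ {R R′ : Relation} {p q k} → Step R R′ p q →
              (∀ {j i} → ¬ (s (suc k) j ≡ p × s k i ≡ q ⊎ s (suc k) j ≡ q × s k i ≡ p)) → Dead R k → Dead R′ k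
  dead-kept S ne D j i τ with Step.from S τ
  ... | inj₁ e       = ne e
  ... | inj₂ (u , _) = D j i u

  token-move : ∀ {k l j i j′ i′} → k ≢ l →
    ¬ (s (suc k) j ≡ s (suc l) j′ × s k i ≡ s l i′ ⊎ s (suc k) j ≡ s l i′ × s k i ≡ s (suc l) j′)
  token-move k≢l (inj₁ (_ , refl)) = k≢l refl
  token-move k≢l (inj₂ (refl , ()))

  seed-move : ∀ {x k l j i i′} → Seed x l →
    ¬ (s (suc k) j ≡ x × s k i ≡ s (suc l) i′ ⊎ s (suc k) j ≡ s (suc l) i′ × s k i ≡ x)
  seed-move (inj₁ refl) (inj₁ (() , _))
  seed-move (inj₁ refl) (inj₂ (_ , ()))
  seed-move (inj₂ refl) (inj₁ (() , _))
  seed-move (inj₂ refl) (inj₂ (_ , ()))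

  module Count {R R′ : Relation} (I : Inv R) (bounded : Bounded R) (I′ : Inv R′) (alive? : TokenDecidable R′) where
    open Inv I

    -- Token `k` with its upper end and token `suc k` with its lower end would each occupy a place
    -- of level `suc k`, and `seed` puts that place below 0.
    barren : ∀ {k} → R (c k) (s (suc k) 0F) → Dead R k × Dead R (suc k)
    barren r = (λ j i τ → n≮0 (seed (inj₂ refl) r (_ , _ , τ))) ,
               (λ j i τ → n≮0 (seed (inj₂ refl) r (_ , _ , symm τ)))

    rise : ∀ {t out out′} → out′ ≤ suc out → out + 10 ≤ t + 2 ^ h * 10 → out′ + 10 ≤ suc t + 2 ^ h * 10
    rise le β = ≤-trans (+-monoˡ-≤ 10 le) (s≤s β)

    stay : ∀ {t out} → out + 10 ≤ t + 2 ^ h * 10 → out + 10 ≤ suc t + 2 ^ h * 10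
    stay = m≤n⇒m≤1+n

    -- While all of tokens 1 to `suc h` live, `barren` excludes births. If token `l` is missing,
    -- only its own birth can end that, and this birth shows token `suc l` to be missing: the gap
    -- climbs. It can close only by a birth of the top token, where the chain is rebuilt from
    -- `ρ = 0`.
    advance : ∀ {p q t} → Move R p q → Step R R′ p q → Progress R t → Progress R′ (suc t)
    advance (slide zero j d r) S (live A β) =
      live (alive-map (λ { {suc _} _ τ → Slide.keep I {d = d} r S (λ ()) (λ ()) τ }) A) (stay β)
      where open Advance
    advance (slide (suc k) j d r) S (live A β) with Advance.Slide.top I {d = d} r S (s≤s z≤n) k≤ A
      where k≤ = ≤-pred (bounded r)
    ... | inj₁ (_ , le , A′) = live A′ (rise le β)
    ... | inj₂ D = dead D
    advance (turn zero j r _ free) S (live A β) =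
      live (alive-map (λ { {suc _} _ τ → Turn.keep I r free S (λ ()) τ }) A) (stay β)
    advance (turn (suc k) j r cut free) S (live A β) =
      live (Turn.top I r free S cut (s≤s z≤n) (≤-pred (bounded r)) A) (stay β)
    advance (birth zero r) S (live A β) with alive-token A (s≤s z≤n) (s≤s z≤n)
    ... | _ , _ , τ = ⊥-elim (proj₂ (barren r) _ _ τ)
    advance (birth (suc k) r) S (live A β) with alive-token A (s≤s z≤n) (≤-pred (bounded (symm r)))
    ... | _ , _ , τ = ⊥-elim (proj₁ (barren r) _ _ τ)
    advance (sow σ free) S (live A β) = live (alive-map (λ _ → sown I (Sow-seed σ) free S) A) (stay β)
    advance (slide k j d r) S (dead (l , 0<l , l≤h , D)) =
      dead (l , 0<l , l≤h , dead-kept S (token-move λ { refl → D _ _ r }) D)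
    advance (turn k j r _ _) S (dead (l , 0<l , l≤h , D)) =
      dead (l , 0<l , l≤h , dead-kept S (token-move λ { refl → D _ _ r }) D)
    advance (sow σ _) S (dead (l , 0<l , l≤h , D)) =
      dead (l , 0<l , l≤h , dead-kept S (seed-move (Sow-seed σ)) D)
    advance {t = t} (birth k r) S (dead (l , 0<l , l≤h , D)) with l ≟ k
    ... | no l≢k = dead (l , 0<l , l≤h , dead-kept S (token-move l≢k) D)
    ... | yes refl with l ≟ suc h
    ... | no l≢h = dead (suc l , s≤s z≤n , ≤∧≢⇒< l≤h l≢h ,
                         dead-kept S (token-move 1+n≢n) (proj₂ (barren r)))
    ... | yes refl with chain-build I′ alive? h 0 (0F , Step.new S)
    ... | inj₂ (m , 0<m , m≤h , D′) = dead (m , 0<m , m≤n⇒m≤1+n m≤h , D′)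
    ... | inj₁ (out , le , ch) = live (alive 0 0F (Step.new S) (s≤s z≤n) ch) (≤-trans le (m≤n+m _ (suc t)))

  -- Moves that remain available when a token is missing

  module Stuck {R : Relation} (I : Inv R) (bounded : Bounded R) (alive? : TokenDecidable R)
               (matched? : ∀ p → (Σ Player λ q → R p q) ⊎ (∀ q → ¬ R p q)) where
    open Inv I

    Blocks : Player → Player → Set
    Blocks p q = Move R p q × Wants R p q × Wants R q p × Present p × Present q

    Blocking : Set
    Blocking = Σ Player λ p → Σ Player λ q → Blocks p q

    wants-upper : ∀ {k j} d → (∀ j′ → ¬ R (s k (foot j d)) (s (suc k) j′)) → Wants R (s k (foot j d)) (s (suc k) j)
    wants-upper {k} {j} d none with matched? (s k (foot j d))
    ... | inj₂ free = unmatched free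
    ... | inj₁ (w , r) = improves r (subst (_< cost (s k (foot j d)) w) (sym (cost-upper k j d)) (bad (edges r) r))
      where
      bad : ∀ {w} → Edge (s k (foot j d)) w → R (s k (foot j d)) w → toℕ d < cost (s k (foot j d)) w
      bad (inj₁ (token {k′} {j″} {i} d′ e)) _ rewrite e | cost-lower k′ j″ d′ =
        ≤-trans (s≤s (toℕ≤pred[n] d)) (≤-trans (m≤m+n 3 5) (∸-monoʳ-≤ 10 (toℕ≤pred[n] d′)))
      bad (inj₂ (token _ _)) r = contradiction r (none _)
      bad (inj₂ (sweep _)) _ = ≤-trans (s≤s (toℕ≤pred[n] d)) (m≤m+n 3 18)
      bad (inj₂ (finish _)) _ = ≤-trans (s≤s (toℕ≤pred[n] d)) (m≤m+n 3 17)

    wants-lower : ∀ {k j i} → ¬ Occupied R (suc k) j → Wants R (s (suc k) j) (s k i)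
    wants-lower {k} {j} {i} none with matched? (s (suc k) j)
    ... | inj₂ free = unmatched free
    ... | inj₁ (w , r) with edges r
    ... | inj₁ (token _ _) = contradiction (_ , _ , r) none
    ... | inj₂ (token _ _) = contradiction (_ , _ , r) none
    ... | inj₂ (sweep _)   = improves r (≤-trans (s≤s (cost-s≤10 (suc k) j k i)) (m≤m+n 11 10))
    ... | inj₂ (finish _)  = improves r (≤-trans (s≤s (cost-s≤10 (suc k) j k i)) (m≤m+n 11 9))

    can-slide : ∀ {k j} (d : Fin 2) → Token R k j (foot j (inject₁ d)) → k ≤ suc h →
                Blocks (s (suc k) j) (s k (foot j (suc d)))
    can-slide {k} {j} d r k≤h = slide k j d r ,
      improves r (subst₂ _<_ (sym (cost-lower k j (suc d))) (sym (cost-lower k j (inject₁ d))) (lt d)) ,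
      wants-upper (suc d) none , s≤s k≤h , m≤n⇒m≤1+n k≤h
      where
      lt : ∀ (d : Fin 2) → 10 ∸ suc (toℕ d) < 10 ∸ toℕ (inject₁ d)
      lt 0F = ≤-refl
      lt 1F = ≤-refl
      ne : ∀ (d : Fin 2) → suc d ≢ inject₁ d
      ne 0F ()
      ne 1F ()
      none : ∀ j′ → ¬ R (s k (foot j (suc d))) (s (suc k) j′)
      none j′ u with one (symm u) r
      ... | refl = ne d (foot-injective j _ _ (s-index (uniq (symm u) r)))

    can-turn : ∀ {k j} → Token R k j (foot j 2F) → ¬ Cut (suc k) j →
               (∀ j′ → ¬ R (s (suc k) (next j)) (s (suc (suc k)) j′)) → k ≤ suc h →
               Blocks (s (suc k) (next j)) (s k (foot j 2F))
    can-turn {k} {j} r cut free k≤h = turn k j r cut free , wants-lower none ,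
      improves (symm r) lt , s≤s k≤h , m≤n⇒m≤1+n k≤h
      where
      none : ¬ Occupied R (suc k) (next j)
      none (_ , _ , u) with edges u
      ... | inj₁ (token _ _) = next-≢ j (one u r)
      ... | inj₂ (token _ _) = free _ u
      lt : cost (s k (foot j 2F)) (s (suc k) (next j)) < cost (s k (foot j 2F)) (s (suc k) j)
      lt rewrite cost-upper k j 2F | foot-turn j | cost-upper k (next j) 0F = s≤s z≤n

    can-birth : ∀ {k} → R (c k) (s (suc k) 0F) → Dead R k → k ≤ suc h → Blocks (s (suc k) 0F) (s k 0F)
    can-birth {k} r D k≤h = birth k r ,
      improves (symm r) (≤-trans (s≤s (cost-s≤10 (suc k) 0F k 0F)) (m≤m+n 11 9)) ,
      wants-upper {k} {0F} 0F (λ j u → D j _ (symm u)) , s≤s k≤h , m≤n⇒m≤1+n k≤h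

    module Barren {k} (k≤h : k ≤ suc h) (D : Dead R k) (D′ : Dead R (suc k)) where

      unoccupied : ∀ {i} → ¬ Occupied R (suc k) i
      unoccupied (_ , _ , u) with edges u
      ... | inj₁ (token _ _) = D _ _ u
      ... | inj₂ (token _ _) = D′ _ _ (symm u)

      only-seeds : ∀ {i w} → R (s (suc k) i) w → (w ≡ b k × i ≢ 0F) ⊎ (w ≡ c k × toℕ i < 2)
      only-seeds u with edges u
      ... | inj₁ (token _ _) = contradiction (_ , _ , u) unoccupied
      ... | inj₂ (token _ _) = contradiction (_ , _ , u) unoccupied
      ... | inj₂ (sweep ne)  = inj₁ (refl , ne)
      ... | inj₂ (finish lt) = inj₂ (refl , lt)

      can-drop : R (c k) (s (suc k) 1F) → Blocks (c k) (s (suc k) 0F)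
      can-drop r = sow (drop r) unoccupied , improves r (s≤s z≤n) , unmatched free , m≤n⇒m≤1+n k≤h , s≤s k≤h
        where
        free : ∀ w → ¬ R (s (suc k) 0F) w
        free w u with only-seeds u
        ... | inj₁ (_ , ne) = ne refl
        ... | inj₂ (refl , _) with uniq r (symm u)
        ... | ()

      can-pass : (∀ q → ¬ R (c k) q) → R (b k) (s (suc k) 1F) → Blocks (c k) (s (suc k) 1F)
      can-pass free r = sow (pass r) unoccupied , unmatched free , improves (symm r) ≤-refl , m≤n⇒m≤1+n k≤h , s≤s k≤h

      can-down : ∀ {i} → (∀ q → ¬ R (c k) q) → i ≢ 0F → i ≢ 4F → R (b k) (s (suc k) (next i)) → Blocks (b k) (s (suc k) i)
      can-down {i} free i≢0 i≢4 r = sow (down i≢0 i≢4 r) unoccupied ,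
        improves r (≤-reflexive (sym (next-cases i (next i) refl i≢4))) , unmatched free′ , m≤n⇒m≤1+n k≤h , s≤s k≤h
        where
        free′ : ∀ w → ¬ R (s (suc k) i) w
        free′ w u with only-seeds u
        ... | inj₁ (refl , _) = next-≢ i (s-index (uniq r (symm u)))
        ... | inj₂ (refl , _) = free _ (symm u)

      can-enter : (∀ q → ¬ R (c k) q) → (∀ q → ¬ R (b k) q) → Blocks (b k) (s (suc k) 4F)
      can-enter free free′ = sow enter unoccupied , unmatched free′ , unmatched none , m≤n⇒m≤1+n k≤h , s≤s k≤h
        where
        none : ∀ w → ¬ R (s (suc k) 4F) w
        none w u with only-seeds u
        ... | inj₁ (refl , _) = free′ _ (symm u)
        ... | inj₂ (refl , _) = free _ (symm u)

      -- The seed that is furthest along can proceed: `c k` if it is matched, otherwise `b k`. Only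
      -- seeds of this pair can stand on the level, so nothing obstructs them.
      can-sow : Blocking
      can-sow with matched? (c k)
      can-sow | inj₁ (w , r) with edges r
      can-sow | inj₁ (_ , r) | inj₁ (finish {i = 0F} _) = _ , _ , can-birth r D k≤h
      can-sow | inj₁ (_ , r) | inj₁ (finish {i = 1F} _) = _ , _ , can-drop r
      can-sow | inj₁ (_ , r) | inj₁ (finish {i = suc (suc _)} (s≤s (s≤s ())))
      can-sow | inj₂ free with matched? (b k)
      can-sow | inj₂ free | inj₂ free′ = _ , _ , can-enter free free′
      can-sow | inj₂ free | inj₁ (w , r) with edges r
      can-sow | inj₂ free | inj₁ (_ , r) | inj₁ (sweep {i = 0F} ne) = contradiction refl ne
      can-sow | inj₂ free | inj₁ (_ , r) | inj₁ (sweep {i = 1F} _) = _ , _ , can-pass free r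
      can-sow | inj₂ free | inj₁ (_ , r) | inj₁ (sweep {i = 2F} _) = _ , _ , can-down {1F} free (λ ()) (λ ()) r
      can-sow | inj₂ free | inj₁ (_ , r) | inj₁ (sweep {i = 3F} _) = _ , _ , can-down {2F} free (λ ()) (λ ()) r
      can-sow | inj₂ free | inj₁ (_ , r) | inj₁ (sweep {i = 4F} _) = _ , _ , can-down {3F} free (λ ()) (λ ()) r

    -- Without token `suc k`, a living token `k` is stopped by nothing but the cut, and a missing
    -- token `k` leaves the level to its seeds.
    can-move : ∀ {k} → k ≤ suc h → Dead R (suc k) → ¬ (k ≡ suc h × Token R k 4F 0F) → Blocking
    can-move {k} k≤h D′ ne with alive? k
    ... | inj₂ D = Barren.can-sow k≤h D D′
    ... | inj₁ (j , i , τ) with edges τ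
    ... | inj₁ (token 0F refl) = _ , _ , can-slide 0F τ k≤h
    ... | inj₁ (token 1F refl) = _ , _ , can-slide 1F τ k≤h
    ... | inj₁ (token 2F refl) = _ , _ , can-turn τ (λ { (refl , refl) → ne (refl , τ) }) (λ j′ u → D′ _ _ (symm u)) k≤h

    -- The top token must have stopped at `a = 4`, `d = 2`, where `wind` is 10. So `chain-lower`
    -- gives `12 * 2 ^ h ≤ out + 2`, against `out + 10 ≤ t + 10 * 2 ^ h`; the difference is
    -- `2 ^ suc h`.
    length-bound : ∀ {t} → ¬ Blocking → Progress R t → 2 ^ suc h ≤ t
    length-bound stuck (dead (suc k , _ , k≤h , D)) =
      ⊥-elim (stuck (can-move (m≤n⇒m≤1+n (≤-pred k≤h)) D λ { (refl , _) → <-irrefl refl k≤h }))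
    length-bound {t} stuck (live {out} (alive a d τ a<5 ch) bound) with residue a ≟ᶠ 4F ×-dec d ≟ᶠ 2F
    -- A token above the top one would need a level beyond `suc (suc h)`, so it counts as dead.
    ... | no ne = ⊥-elim (stuck (can-move ≤-refl (λ j i u → <-irrefl refl (bounded u)) λ (_ , u) → ne (end u)))
      where
      end : Token R (suc h) 4F 0F → residue a ≡ 4F × d ≡ 2F
      end u with one u τ
      ... | e = sym e , foot-injective 4F d 2F (trans (cong (λ z → foot z d) e)
                  (s-index (uniq (subst (λ z → Token R (suc h) z (foot (residue a) d)) (sym e) τ) u)))
    ... | yes (a≡4 , refl) = +-cancelʳ-≤ (2 ^ h * 10) _ _ (begin
        2 ^ suc h + 2 ^ h * 10  ≡⟨ lemma (2 ^ h) ⟩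
        2 ^ h * (10 + 2)        ≡⟨ cong (λ z → 2 ^ h * (wind z 2F + 2)) (sym a≡) ⟩
        2 ^ h * (wind a 2F + 2) ≤⟨ chain-lower ch ⟩
        out + 2                 ≤⟨ +-monoʳ-≤ out (m≤m+n 2 8) ⟩
        out + 10                ≤⟨ bound ⟩
        t + 2 ^ h * 10 ∎)
      where
      open ≤-Reasoning
      lemma : ∀ x → 2 * x + x * 10 ≡ x * 12
      lemma = solve-∀
      a≡ : a ≡ 4
      a≡ = go a a<5 a≡4
        where
        go : ∀ a → a < 5 → residue a ≡ 4F → a ≡ 4
        go 4 _ _ = refl
        go (suc (suc (suc (suc (suc _))))) (s≤s (s≤s (s≤s (s≤s (s≤s ()))))) _

  -- Numbering the players, eight to a level

  seat : ℕ → Fin 8 → Player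
  seat k 0F = s k 0F
  seat k 1F = s k 1F
  seat k 2F = s k 2F
  seat k 3F = s k 3F
  seat k 4F = s k 4F
  seat k 5F = b k
  seat k 6F = c k
  seat k 7F = y k

  level : Player → ℕ
  level (s k _) = k
  level (b k)   = k
  level (c k)   = k
  level (y k)   = k

  place : Player → Fin 8
  place (s _ 0F) = 0F
  place (s _ 1F) = 1F
  place (s _ 2F) = 2F
  place (s _ 3F) = 3F
  place (s _ 4F) = 4F
  place (b _)    = 5F
  place (c _)    = 6F
  place (y _)    = 7F

  seat-place : ∀ p → seat (level p) (place p) ≡ p
  seat-place (s _ 0F) = refl
  seat-place (s _ 1F) = refl
  seat-place (s _ 2F) = refl
  seat-place (s _ 3F) = refl
  seat-place (s _ 4F) = refl
  seat-place (b _)    = refl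
  seat-place (c _)    = refl
  seat-place (y _)    = refl

  level-seat : ∀ k r → level (seat k r) ≡ k × place (seat k r) ≡ r
  level-seat k 0F = refl , refl
  level-seat k 1F = refl , refl
  level-seat k 2F = refl , refl
  level-seat k 3F = refl , refl
  level-seat k 4F = refl , refl
  level-seat k 5F = refl , refl
  level-seat k 6F = refl , refl
  level-seat k 7F = refl , refl

  levels size : ℕ
  levels = suc (suc (suc h))
  size = levels * 8

  abstract
    player : Fin size → Player
    player u = seat (toℕ (proj₁ (remQuot {levels} 8 u))) (proj₂ (remQuot {levels} 8 u))

    player-injective : ∀ {u v} → player u ≡ player v → u ≡ v
    player-injective {u} {v} eq = begin
      u ≡⟨ sym (combine-remQuot {levels} 8 u) ⟩
      combine (proj₁ (remQuot {levels} 8 u)) (proj₂ (remQuot {levels} 8 u)) ≡⟨ cong₂ combine (toℕ-injective lev) pl ⟩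
      combine (proj₁ (remQuot {levels} 8 v)) (proj₂ (remQuot {levels} 8 v)) ≡⟨ combine-remQuot {levels} 8 v ⟩
      v ∎
      where
      open ≡-Reasoning
      lev : toℕ (proj₁ (remQuot {levels} 8 u)) ≡ toℕ (proj₁ (remQuot {levels} 8 v))
      lev = trans (sym (proj₁ (level-seat _ (proj₂ (remQuot {levels} 8 u)))))
              (trans (cong level eq) (proj₁ (level-seat _ (proj₂ (remQuot {levels} 8 v)))))
      pl : proj₂ (remQuot {levels} 8 u) ≡ proj₂ (remQuot {levels} 8 v)
      pl = trans (sym (proj₂ (level-seat (toℕ (proj₁ (remQuot {levels} 8 u))) _)))
              (trans (cong place eq) (proj₂ (level-seat (toℕ (proj₁ (remQuot {levels} 8 v))) _)))

    player-level : ∀ u → level (player u) ≤ suc (suc h)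
    player-level u rewrite proj₁ (level-seat (toℕ (proj₁ (remQuot {levels} 8 u))) (proj₂ (remQuot {levels} 8 u))) =
      ≤-pred (toℕ<n (proj₁ (remQuot {levels} 8 u)))

    index : ∀ p → level p ≤ suc (suc h) → Σ (Fin size) λ u → player u ≡ p
    index p le = combine q (place p) , trans (cong (λ x → seat (toℕ (proj₁ x)) (proj₂ x)) (remQuot-combine q (place p)))
                                        (trans (cong (λ k → seat k (place p)) (toℕ-fromℕ< (s≤s le))) (seat-place p))
      where
      q : Fin levels
      q = fromℕ< (s≤s le)

  present-level : ∀ p → Present p → level p ≤ suc (suc h)
  present-level (s _ _) le = le
  present-level (b _) le = le
  present-level (c _) le = le
  present-level (y _) le = le

  Cut? : ∀ k i → Dec (Cut k i)
  Cut? k i = (k ≟ suc (suc h)) ×-dec (i ≟ᶠ 4F)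

  Link? : ∀ p q → Dec (Link p q)
  Link? (s k i) (s l j) = map′
    (λ { (refl , inj₁ (e , ct)) → fwd e ct ; (refl , inj₂ (e , ct)) → bwd e ct })
    (λ { (fwd e ct) → refl , inj₁ (e , ct) ; (bwd e ct) → refl , inj₂ (e , ct) })
    ((k ≟ l) ×-dec ((j ≟ᶠ next i) ×-dec ¬? (Cut? k i) ⊎-dec (i ≟ᶠ next j) ×-dec ¬? (Cut? k j)))
  Link? (s k i) (b _)   = no λ ()
  Link? (s k i) (c l)   = map′ (λ { (refl , e) → sc e }) (λ { (sc e) → refl , e }) ((k ≟ l) ×-dec (i ≟ᶠ 0F))
  Link? (s k i) (y l)   = map′ (λ { (refl , e) → sy e }) (λ { (sy e) → refl , e }) ((k ≟ suc l) ×-dec (i ≟ᶠ 4F))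
  Link? (b _)   (s _ _) = no λ ()
  Link? (b _)   (b _)   = no λ ()
  Link? (b k)   (c l)   = map′ (λ { refl → bc }) (λ { bc → refl }) (k ≟ l)
  Link? (b k)   (y l)   = map′ (λ { refl → by }) (λ { by → refl }) (k ≟ l)
  Link? (c k)   (s l i) = map′ (λ { (refl , e) → cs e }) (λ { (cs e) → refl , e }) ((k ≟ l) ×-dec (i ≟ᶠ 0F))
  Link? (c k)   (b l)   = map′ (λ { refl → cb }) (λ { cb → refl }) (k ≟ l)
  Link? (c _)   (c _)   = no λ ()
  Link? (c _)   (y _)   = no λ ()
  Link? (y k)   (s l i) = map′ (λ { (refl , e) → ys e }) (λ { (ys e) → refl , e }) ((l ≟ suc k) ×-dec (i ≟ᶠ 4F))
  Link? (y k)   (b l)   = map′ (λ { refl → yb }) (λ { yb → refl }) (k ≟ l)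
  Link? (y _)   (c _)   = no λ ()
  Link? (y _)   (y _)   = no λ ()

  Edge₀? : ∀ p q → Dec (Edge₀ p q)
  Edge₀? (s k j) (s l i) = map′ (λ { (refl , d , e) → token d e }) (λ { (token d e) → refl , d , e })
                             ((k ≟ suc l) ×-dec any? λ d → i ≟ᶠ foot j d)
  Edge₀? (b k)   (s l i) = map′ (λ { (refl , e) → sweep e }) (λ { (sweep e) → refl , e }) ((l ≟ suc k) ×-dec ¬? (i ≟ᶠ 0F))
  Edge₀? (c k)   (s l i) = map′ (λ { (refl , e) → finish e }) (λ { (finish e) → refl , e }) ((l ≟ suc k) ×-dec (toℕ i <? 2))
  Edge₀? (y _)   (s _ _) = no λ ()
  Edge₀? _       (b _)   = no λ ()
  Edge₀? _       (c _)   = no λ ()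
  Edge₀? _       (y _)   = no λ ()

  Edge? : ∀ p q → Dec (Edge p q)
  Edge? p q = Edge₀? p q ⊎-dec Edge₀? q p

  -- The finite game is well-formed and bipartite

  game : Game size
  link game u v = ⌊ Link? (player u) (player v) ⌋
  edge game u v = ⌊ Edge? (player u) (player v) ⌋
  rank game u v = cost (player u) (player v)

  holds : ∀ {P : Set} (d : Dec P) → ⌊ d ⌋ ≡ true → P
  holds (yes p) _ = p

  holds⁻ : ∀ {P : Set} (d : Dec P) → P → ⌊ d ⌋ ≡ true
  holds⁻ (yes _) _ = refl
  holds⁻ (no ¬p) p = contradiction p ¬p

  fails⁻ : ∀ {P : Set} (d : Dec P) → ¬ P → ⌊ d ⌋ ≡ false
  fails⁻ (yes p) ¬p = contradiction p ¬p
  fails⁻ (no _) _ = refl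

  Link-sym : ∀ {p q} → Link p q → Link q p
  Link-sym (fwd e ct) = bwd e ct
  Link-sym (bwd e ct) = fwd e ct
  Link-sym bc = cb
  Link-sym cb = bc
  Link-sym (cs e) = sc e
  Link-sym (sc e) = cs e
  Link-sym by = yb
  Link-sym yb = by
  Link-sym (ys e) = sy e
  Link-sym (sy e) = ys e

  Link-irrefl : ∀ {p} → ¬ Link p p
  Link-irrefl (fwd e _) = next-≢ _ (sym e)
  Link-irrefl (bwd e _) = next-≢ _ (sym e)

  foot-injectiveˡ : ∀ d j j′ → foot j d ≡ foot j′ d → j ≡ j′
  foot-injectiveˡ = from-yes (all? λ d → all? λ j → all? λ j′ → (foot j d ≟ᶠ foot j′ d) →-dec (j ≟ᶠ j′))

  10∸-injective : ∀ (d d′ : Fin 3) → 10 ∸ toℕ d ≡ 10 ∸ toℕ d′ → d ≡ d′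
  10∸-injective = from-yes (all? λ (d : Fin 3) → all? λ (d′ : Fin 3) → (10 ∸ toℕ d ≟ 10 ∸ toℕ d′) →-dec (d ≟ᶠ d′))

  upper≢lower : ∀ (d d′ : Fin 3) → toℕ d ≢ 10 ∸ toℕ d′
  upper≢lower = from-yes (all? λ (d : Fin 3) → all? λ (d′ : Fin 3) → ¬? (toℕ d ≟ 10 ∸ toℕ d′))

  cost-s≢ : ∀ k i l j {r} → 10 < r → cost (s k i) (s l j) ≢ r
  cost-s≢ k i l j lt e = <⇒≢ (≤-<-trans (cost-s≤10 k i l j) lt) e

  -- For an `s` player the kinds of partner have disjoint ranges: 0 to 2 above, 8 to 10 below, 20
  -- for `c`, 21 for `b`. Within one kind the stage determines the partner.
  cost-injective : ∀ {p q q′} → Edge p q → Edge p q′ → cost p q ≡ cost p q′ → q ≡ q′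
  cost-injective (inj₁ (token {k} {j} d refl)) (inj₁ (token d′ refl)) e
    rewrite cost-lower k j d | cost-lower k j d′ | 10∸-injective d d′ e = refl
  cost-injective (inj₁ (token {k} {j} d refl)) (inj₂ (token {j = j′} d′ refl)) e
    rewrite cost-lower k (foot j′ d′) d | cost-upper (suc k) j′ d′ = contradiction (sym e) (upper≢lower d′ d)
  cost-injective (inj₂ (token {j = j′} d′ refl)) (inj₁ (token {k} {j} d refl)) e
    rewrite cost-lower k (foot j′ d′) d | cost-upper (suc k) j′ d′ = contradiction e (upper≢lower d′ d)
  cost-injective (inj₂ (token {k} {j} d refl)) (inj₂ (token {j = j′} d′ eq)) e
    rewrite cost-upper k j d with toℕ-injective (trans e (trans (cong (λ z → cost (s k z) (s (suc k) j′)) eq) (cost-upper k j′ d′)))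
  ... | refl = cong (s (suc k)) (foot-injectiveˡ d j j′ eq)
  cost-injective (inj₁ (sweep _)) (inj₁ (sweep _)) e = cong (s _) (toℕ-injective e)
  cost-injective (inj₁ (finish _)) (inj₁ (finish _)) e = cong (s _) (toℕ-injective e)
  cost-injective (inj₂ (sweep _)) (inj₂ (sweep _)) _ = refl
  cost-injective (inj₂ (finish _)) (inj₂ (finish _)) _ = refl
  cost-injective (inj₂ (sweep _)) (inj₂ (finish _)) ()
  cost-injective (inj₂ (finish _)) (inj₂ (sweep _)) ()
  cost-injective (inj₁ (token {k} {j} {i} _ _)) (inj₂ (sweep _)) e = contradiction e (cost-s≢ (suc k) j k i (m≤m+n 11 10))
  cost-injective (inj₂ (sweep _)) (inj₁ (token {k} {j} {i} _ _)) e = contradiction (sym e) (cost-s≢ (suc k) j k i (m≤m+n 11 10))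
  cost-injective (inj₂ (token {k} {j} {i} _ _)) (inj₂ (sweep _)) e = contradiction e (cost-s≢ k i (suc k) j (m≤m+n 11 10))
  cost-injective (inj₂ (sweep _)) (inj₂ (token {k} {j} {i} _ _)) e = contradiction (sym e) (cost-s≢ k i (suc k) j (m≤m+n 11 10))
  cost-injective (inj₁ (token {k} {j} {i} _ _)) (inj₂ (finish _)) e = contradiction e (cost-s≢ (suc k) j k i (m≤m+n 11 9))
  cost-injective (inj₂ (finish _)) (inj₁ (token {k} {j} {i} _ _)) e = contradiction (sym e) (cost-s≢ (suc k) j k i (m≤m+n 11 9))
  cost-injective (inj₂ (token {k} {j} {i} _ _)) (inj₂ (finish _)) e = contradiction e (cost-s≢ k i (suc k) j (m≤m+n 11 9))
  cost-injective (inj₂ (finish _)) (inj₂ (token {k} {j} {i} _ _)) e = contradiction (sym e) (cost-s≢ k i (suc k) j (m≤m+n 11 9))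

  wellFormed : WellFormed game
  WellFormed.link-sym wellFormed u v e = holds⁻ (Link? _ _) (Link-sym (holds (Link? (player u) (player v)) e))
  WellFormed.link-irr wellFormed u = fails⁻ (Link? (player u) (player u)) Link-irrefl
  WellFormed.edge-sym wellFormed u v e = holds⁻ (Edge? _ _) (swap (holds (Edge? (player u) (player v)) e))
  WellFormed.edge-irr wellFormed u = fails⁻ (Edge? (player u) (player u)) [ Edge₀-irrefl , Edge₀-irrefl ]′
  WellFormed.rank-inj wellFormed v w w′ e e′ eq = player-injective
    (cost-injective (holds (Edge? (player v) (player w)) e) (holds (Edge? (player v) (player w′)) e′) eq)

  even : ℕ → Bool
  even zero    = true
  even (suc k) = not (even k)

  Edge₀-parity : ∀ {p q} → Edge₀ p q → even (level p) ≢ even (level q)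
  Edge₀-parity (token {k} _ _) e = not-¬ {even k} refl (sym e)
  Edge₀-parity (sweep {k} _) e = not-¬ {even k} refl e
  Edge₀-parity (finish {k} _) e = not-¬ {even k} refl e

  bipartite : Bipartite game
  bipartite = (λ u → even (level (player u))) , λ u v e →
    [ Edge₀-parity , (λ e₀ → ≢-sym (Edge₀-parity e₀)) ]′ (holds (Edge? (player u) (player v)) e)

  -- Translation between states and relations

  data Lift (M : State size) (p q : Player) : Set where
    lifted : ∀ u v → player u ≡ p → player v ≡ q → M u v ≡ true → Lift M p q

  lift : ∀ {M u v} → M u v ≡ true → Lift M (player u) (player v)
  lift {u = u} {v} = lifted u v refl refl

  unlift : ∀ {M u v} → Lift M (player u) (player v) → M u v ≡ true
  unlift {u = u} {v} (lifted u′ v′ eq eq′ e) with player-injective {u′} {u} eq | player-injective {v′} {v} eq′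
  ... | refl | refl = e

  lift-present : ∀ {M p q} → Lift M p q → level p ≤ suc (suc h)
  lift-present (lifted u _ refl _ _) = player-level u

  lift-bounded : ∀ M → Bounded (Lift M)
  lift-bounded M r = lift-present r

  locate : ∀ p → Dec (Σ (Fin size) λ u → player u ≡ p)
  locate p with level p ≤? suc (suc h)
  ... | yes le = yes (index p le)
  ... | no ¬le = no λ { (u , refl) → ¬le (player-level u) }

  matched? : ∀ M p → (Σ Player λ q → Lift M p q) ⊎ (∀ q → ¬ Lift M p q)
  matched? M p with locate p
  ... | no ¬u = inj₂ λ { _ (lifted u _ eq _ _) → ¬u (u , eq) }
  ... | yes (u , refl) with any? (λ v → M u v ≟ᵇ true)
  ... | yes (v , e) = inj₁ (player v , lift e)
  ... | no none = inj₂ λ { _ (lifted _ v eq refl e) → none (v , unlift {M} (lifted _ v eq refl e)) }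

  lift? : ∀ M p q → Dec (Lift M p q)
  lift? M p q with locate p | locate q
  ... | no ¬u | _ = no λ { (lifted u _ eq _ _) → ¬u (u , eq) }
  ... | _ | no ¬v = no λ { (lifted _ v _ eq _) → ¬v (v , eq) }
  ... | yes (u , refl) | yes (v , refl) with M u v ≟ᵇ true
  ... | yes e = yes (lift e)
  ... | no ¬e = no λ r → ¬e (unlift r)

  token? : ∀ M → TokenDecidable (Lift M)
  token? M k with any? (λ j → any? (λ i → lift? M (s (suc k) j) (s k i)))
  ... | yes (j , i , τ) = inj₁ (j , i , τ)
  ... | no none = inj₂ λ j i τ → none (j , i , τ)

  lift-adjacent : ∀ {M u v} → Adj game M u v → Adjacent (Lift M) (player u) (player v)
  lift-adjacent {u = u} {v} (inj₁ e) = inj₁ (holds (Link? (player u) (player v)) e)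
  lift-adjacent (inj₂ e) = inj₂ (lift e)

  lift-access : ∀ {M u v} → Accessible game M u v → Access (Lift M) (player u) (player v)
  lift-access (inj₁ refl) = inj₁ refl
  lift-access (inj₂ (inj₁ a)) = inj₂ (inj₁ (lift-adjacent a))
  lift-access (inj₂ (inj₂ (w , a , a′))) = inj₂ (inj₂ (player w , lift-adjacent a , lift-adjacent a′))

  lift-wants : ∀ {M u v} → WantsSwitch game M u v → Wants (Lift M) (player u) (player v)
  lift-wants {M} {u} {w} (inj₁ free) = unmatched λ { _ (lifted _ v eq refl e) →
    contradiction (trans (sym (unlift {M} {u} {v} (lifted _ v eq refl e))) (free v)) λ () }
  lift-wants (inj₂ (w , e , lt)) = improves (lift e) lt

  Access-sym : ∀ {R p q} → Inv R → Access R p q → Access R q p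
  Access-sym {R} I A = go A
    where
    flip : ∀ {p q} → Adjacent R p q → Adjacent R q p
    flip (inj₁ l) = inj₁ (Link-sym l)
    flip (inj₂ r) = inj₂ (Inv.symm I r)
    go : ∀ {p q} → Access R p q → Access R q p
    go (inj₁ e) = inj₁ (sym e)
    go (inj₂ (inj₁ a)) = inj₂ (inj₁ (flip a))
    go (inj₂ (inj₂ (w , a , a′))) = inj₂ (inj₂ (w , flip a′ , flip a))

  Move-of : ∀ {M u v} → Inv (Lift M) → LocalBlockingPair game M u v →
            Move (Lift M) (player u) (player v) ⊎ Move (Lift M) (player v) (player u)
  Move-of {u = u} {v} I (e , A , W , V) with holds (Edge? (player u) (player v)) e
  ... | inj₁ e₀ = inj₁ (Classify.classify I e₀ (lift-access A) (lift-wants W) (lift-wants V))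
  ... | inj₂ e₀ = inj₂ (Classify.classify I e₀ (Access-sym I (lift-access A)) (lift-wants V) (lift-wants W))

  Step-sym : ∀ {R R′ p q} → Step R R′ p q → Step R R′ q p
  Step.new (Step-sym S) = Step.new′ S
  Step.new′ (Step-sym S) = Step.new S
  Step.kept (Step-sym S) r (a , a′) (e , e′) = Step.kept S r (a′ , a) (e′ , e)
  Step.from (Step-sym S) r with Step.from S r
  ... | inj₁ e = inj₁ (swap e)
  ... | inj₂ (u , (a , a′) , (e , e′)) = inj₂ (u , (a′ , a) , (e′ , e))

  module _ {M M′ : State size} {u v : Fin size}
    (char : ∀ x z → (M′ x z ≡ true → ((x ≡ u × z ≡ v) ⊎ (x ≡ v × z ≡ u)) ⊎ (M x z ≡ true × ¬ (x ∈₂ u , v) × ¬ (z ∈₂ u , v))) ×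
                    (((x ≡ u × z ≡ v) ⊎ (x ≡ v × z ≡ u)) ⊎ (M x z ≡ true × ¬ (x ∈₂ u , v) × ¬ (z ∈₂ u , v)) → M′ x z ≡ true)) where

    lift-step : Step (Lift M) (Lift M′) (player u) (player v)
    Step.new lift-step = lift (proj₂ (char u v) (inj₁ (inj₁ (refl , refl))))
    Step.new′ lift-step = lift (proj₂ (char v u) (inj₁ (inj₂ (refl , refl))))
    Step.kept lift-step (lifted x z refl refl e) (a , a′) (d , d′) = lift (proj₂ (char x z) (inj₂ (e ,
      [ (λ { refl → a refl }) , (λ { refl → a′ refl }) ]′ , [ (λ { refl → d refl }) , (λ { refl → d′ refl }) ]′)))
    Step.from lift-step (lifted x z refl refl e) with proj₁ (char x z) e
    ... | inj₁ (inj₁ (refl , refl)) = inj₁ (inj₁ (refl , refl))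
    ... | inj₁ (inj₂ (refl , refl)) = inj₁ (inj₂ (refl , refl))
    ... | inj₂ (e′ , a , d) = inj₂ (lift e′ ,
      ((λ eq → a (inj₁ (player-injective {x} {u} eq))) , λ eq → a (inj₂ (player-injective {x} {v} eq))) ,
      ((λ eq → d (inj₁ (player-injective {z} {u} eq))) , λ eq → d (inj₂ (player-injective {z} {v} eq))))

  step-move : ∀ {M M′} → Inv (Lift M) → LocalStep game M M′ →
              Σ Player λ p → Σ Player λ q → Move (Lift M) p q × Step (Lift M) (Lift M′) p q
  step-move I (u , v , B , char) with Move-of I B
  ... | inj₁ m = player u , player v , m , lift-step char
  ... | inj₂ m = player v , player u , m , Step-sym (lift-step char)

  lift-empty : ∀ {p q} → ¬ Lift empty p q
  lift-empty (lifted _ _ _ _ ())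

  inv-empty : Inv (Lift empty)
  Inv.symm inv-empty r = ⊥-elim (lift-empty r)
  Inv.edges inv-empty r = ⊥-elim (lift-empty r)
  Inv.uniq inv-empty r _ = ⊥-elim (lift-empty r)
  Inv.one inv-empty r _ = ⊥-elim (lift-empty r)
  Inv.seed inv-empty _ r _ = ⊥-elim (lift-empty r)

  inv-matching : ∀ {M} → Inv (Lift M) → IsMatching game M
  IsMatching.sym (inv-matching I) u v e = unlift (Inv.symm I (lift e))
  IsMatching.⊆E (inv-matching I) u v e = holds⁻ (Edge? (player u) (player v)) (Inv.edges I (lift e))
  IsMatching.unique (inv-matching I) u v w e e′ = player-injective (Inv.uniq I (lift e) (lift e′))

  rematched? : ∀ (M : State size) (u v x z : Fin size) →
    Dec (((x ≡ u × z ≡ v) ⊎ (x ≡ v × z ≡ u)) ⊎ (M x z ≡ true × ¬ (x ∈₂ u , v) × ¬ (z ∈₂ u , v)))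
  rematched? M u v x z = ((x ≟ᶠ u) ×-dec (z ≟ᶠ v) ⊎-dec (x ≟ᶠ v) ×-dec (z ≟ᶠ u)) ⊎-dec
    (M x z ≟ᵇ true) ×-dec ¬? ((x ≟ᶠ u) ⊎-dec (x ≟ᶠ v)) ×-dec ¬? ((z ≟ᶠ u) ⊎-dec (z ≟ᶠ v))

  rematch : State size → Fin size → Fin size → State size
  rematch M u v x z = ⌊ rematched? M u v x z ⌋

  module Realise {M : State size} (I : Inv (Lift M)) where
    open Stuck I (lift-bounded M) (token? M) (matched? M) using (Blocks; Blocking)

    drop-wants : ∀ {u v} → Wants (Lift M) (player u) (player v) → WantsSwitch game M u v
    drop-wants {u} (unmatched free) = inj₁ λ w → ¬-not λ e → free _ (lift e)
    drop-wants {u} {v} (improves (lifted _ w eq refl e) lt) = inj₂ (w , unlift {M} (lifted _ w eq refl e) , lt)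

    drop-link : ∀ {u v} → Link (player u) (player v) → Adj game M u v
    drop-link {u} {v} l = inj₁ (holds⁻ (Link? (player u) (player v)) l)

    via : ∀ {u v w} → Adj game M u w → Adj game M w v → Accessible game M u v
    via a a′ = inj₂ (inj₂ (_ , a , a′))

    via-ml : ∀ {u v p q w} → player u ≡ p → player v ≡ q → Lift M p w → Link w q → Accessible game M u v
    via-ml {u} refl refl (lifted _ w eq refl e) l = via (inj₂ (unlift {M} {u} {w} (lifted _ w eq refl e))) (drop-link l)

    via-lm : ∀ {u v p q w} → player u ≡ p → player v ≡ q → Link p w → Lift M w q → Accessible game M u v
    via-lm {v = v} refl refl l (lifted w _ refl eq e) = via (drop-link l) (inj₂ (unlift {M} {w} {v} (lifted w _ refl eq e)))

    drop-access : ∀ {p q u v} → Move (Lift M) p q → player u ≡ p → player v ≡ q → Present q → Accessible game M u v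
    drop-access (slide k j d r) eu ev pr = via-ml eu ev r (fwd (foot-slide j d) (uncut d))
      where
      uncut : ∀ {i} (d : Fin 2) → ¬ Cut k i
      uncut _ (refl , _) = <-irrefl refl (lift-present r)
    drop-access (turn k j r cut _) eu ev pr = via-lm eu ev (bwd refl cut) r
    drop-access (birth k r) eu ev pr = via-ml eu ev (Inv.symm I r) (cs refl)
    -- The intermediate player `y k` exists because it is one level below the target.
    drop-access (sow (enter {k}) _) eu ev pr with index (y k) (≤-trans (n≤1+n k) pr)
    ... | w , ew = via (drop-link (subst₂ Link (sym eu) (sym ew) by)) (drop-link (subst₂ Link (sym ew) (sym ev) (ys refl)))
    drop-access (sow (down {k} {i} _ i≢4 r) _) eu ev pr = via-ml eu ev r (bwd refl λ (_ , e) → i≢4 e)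
    drop-access (sow (pass r) _) eu ev pr = via-lm eu ev cb r
    drop-access (sow (drop r) _) eu ev pr = via-ml eu ev r (bwd refl λ ())

    pair : ∀ {p q} → Blocks p q → Σ (Fin size) λ u → Σ (Fin size) λ v →
           player u ≡ p × player v ≡ q × LocalBlockingPair game M u v
    pair {p} {q} (m , W , V , pp , pq) with index p (present-level p pp) | index q (present-level q pq)
    ... | u , refl | v , refl = u , v , refl , refl ,
      holds⁻ (Edge? (player u) (player v)) (inj₁ (Move-edge m)) , drop-access m refl refl pq , drop-wants W , drop-wants V

    stuck : LocallyStable game M → ¬ Blocking
    stuck (_ , none) (_ , _ , B) with pair B
    ... | u , v , _ , _ , L = none u v L

    realise : ∀ {p q} → Blocks p q → Σ (State size) λ M′ → LocalStep game M M′ × Step (Lift M) (Lift M′) p q × Inv (Lift M′)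
    realise B with pair B
    ... | u , v , refl , refl , L = rematch M u v , (u , v , L , char) , S , Preservation.preserved I (proj₁ B) S
      where
      char : ∀ x z → _
      char x z = holds (rematched? M u v x z) , holds⁻ (rematched? M u v x z)
      S : Step (Lift M) (Lift (rematch M u v)) (player u) (player v)
      S = lift-step char

  -- The exponential lower bound

  progress : ∀ {M M′ t t₀} → Inv (Lift M) → Progress (Lift M) t₀ → Reach game M M′ t →
             Inv (Lift M′) × Progress (Lift M′) (t₀ + t)
  progress {M} {t₀ = t₀} I P done = I , subst (Progress (Lift M)) (sym (+-identityʳ t₀)) P
  progress {M′ = M″} {t = suc t} {t₀} I P (step {M' = M′} st rest) with step-move I st
  ... | p , q , m , S with Preservation.preserved I m S
  ... | I′ with progress I′ (Count.advance I (lift-bounded _) I′ (token? M′) m S P) rest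
  ... | I″ , P″ = I″ , subst (Progress (Lift M″)) (sym (+-suc t₀ t)) P″

  lower-bound : ∀ M t → Reach game empty M t → LocallyStable game M → 2 ^ suc h ≤ t
  -- The count starts from the empty matching in the state `dead`, with token 1 as the missing one.
  lower-bound M t path stable with progress inv-empty (dead (1 , s≤s z≤n , s≤s z≤n , λ j i → lift-empty)) path
  ... | I , P = Stuck.length-bound I (lift-bounded M) (token? M) (matched? M) (Realise.stuck I stable) P

  -- Composing sequences of steps

  reach-trans : ∀ {M M′ M″ : State size} {t t′} → Reach game M M′ t → Reach game M′ M″ t′ → Reach game M M″ (t + t′)
  reach-trans done       ρ′ = ρ′
  reach-trans (step x ρ) ρ′ = step x (reach-trans ρ ρ′)

  -- The number of steps is existential: for reachability only finiteness matters.
  record Reached (M : State size) (P : Relation → Set) : Set where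
    constructor reached
    field
      {target} : State size
      {time}   : ℕ
      path     : Reach game M target time
      inv      : Inv (Lift target)
      goal     : P (Lift target)

  _>>=_ : ∀ {M P Q} → Reached M P → (∀ {M′} → Inv (Lift M′) → P (Lift M′) → Reached M′ Q) → Reached M Q
  reached ρ I p >>= f with f I p
  ... | reached ρ′ I′ q = reached (reach-trans ρ ρ′) I′ q

  module _ {M : State size} (I : Inv (Lift M)) where
    open Stuck I (lift-bounded M) (token? M) (matched? M) public

    move : ∀ {p q P} → Blocks p q → (∀ {R′} → Step (Lift M) R′ p q → Inv R′ → P R′) → Reached M P
    move B f with Realise.realise I B
    ... | M′ , st , S , I′ = reached (step st done) I′ (f S I′)

  -- Moving one token without losing another

  AllUp : Relation → ℕ → Set
  AllUp R m = ∀ {l} → l < m → Σ (Fin 5) λ j → Σ (Fin 5) λ i → Token R l j i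

  Fresh : Relation → ℕ → Set
  Fresh R m = ∀ {k i w} → m ≤ k → ¬ R (s (suc k) i) w

  KeptAbove : Relation → Relation → ℕ → Set
  KeptAbove R R′ k = ∀ {l j i} → k < l → Token R l j i → Token R′ l j i

  Clear : Relation → ℕ → Fin 5 → Set
  Clear R k j = ¬ Cut (suc k) j × (∀ j′ → ¬ R (s (suc k) (next j)) (s (suc (suc k)) j′))

  nextⱼ : Fin 5 → Fin 3 → Fin 5
  nextⱼ j 0F = j
  nextⱼ j 1F = j
  nextⱼ j 2F = next j

  nextₔ : Fin 3 → Fin 3
  nextₔ 0F = 1F
  nextₔ 1F = 2F
  nextₔ 2F = 0F

  record Ticked (R R′ : Relation) (m k : ℕ) (j : Fin 5) (d : Fin 3) : Set where
    constructor ticked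
    field
      up    : AllUp R′ m
      fresh : Fresh R′ m
      here  : Token R′ k j (foot j d)
      above : KeptAbove R R′ k

  -- Only a turn can be blocked from above, hence the clearance asked for at `d ≡ 2F`. A slide
  -- endangers only the token below, and the schedule moves that token away by itself.
  Tick : ℕ → ℕ → Set
  Tick m k = ∀ {M j} d → Inv (Lift M) → AllUp (Lift M) m → Fresh (Lift M) m → Token (Lift M) k j (foot j d) →
    (d ≡ 2F → Clear (Lift M) k j) → Reached M λ R′ → Ticked (Lift M) R′ m k (nextⱼ j d) (nextₔ d)

  fresh-step : ∀ {R R′ k m a e} → Step R R′ (s (suc k) a) (s k e) → k < m → Fresh R m → Fresh R′ m
  fresh-step S k<m fr m≤k r with Step.from S r
  ... | inj₁ (inj₁ (refl , _)) = <⇒≱ k<m m≤k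
  ... | inj₁ (inj₂ (refl , _)) = <⇒≱ k<m (m≤n⇒m≤1+n m≤k)
  ... | inj₂ (u , _) = fr m≤k u

  ticked-step : ∀ {R R′ k m j d} → k < m → AllUp R m → Fresh R m →
    (∀ {l i i′} → l ≢ k → Token R l i i′ → Token R′ l i i′) → Step R R′ (s (suc k) j) (s k (foot j d)) →
    Ticked R R′ m k j d
  ticked-step {R} {R′} {k} {m} k<m up fr keep S = ticked up′ (fresh-step S k<m fr) (Step.new S) λ k<l → keep (>⇒≢ k<l)
    where
    up′ : AllUp R′ m
    up′ {l} l<m with l ≟ k
    ... | yes refl = _ , _ , Step.new S
    ... | no l≢k with up l<m
    ... | j , i , τ = j , i , keep l≢k τ

  module _ {m k} (tick : Tick m k) {j : Fin 5} where

    -- Clearance is required only in the state just before the turn. The earlier ticks may shift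
    -- tokens below `k`, so it must be derivable from what they preserve, the tokens above `k`.
    Leave : Fin 3 → Set₁
    Leave d = ∀ {M} → Inv (Lift M) → AllUp (Lift M) m → Fresh (Lift M) m → Token (Lift M) k j (foot j d) →
      (∀ {R′} → Inv R′ → Fresh R′ m → KeptAbove (Lift M) R′ k → Clear R′ k j) →
      Reached M λ R′ → Ticked (Lift M) R′ m k (next j) 0F

    leave-after : ∀ d → (d ≡ 2F → ⊥) → nextⱼ j d ≡ j → Leave (nextₔ d) → Leave d
    leave-after d d≢2 e rest {M} I up fr τ clear = tick d I up fr τ (λ d≡2 → contradiction d≡2 d≢2) >>= λ {M′} I′ T →
      rest I′ (Ticked.up T) (Ticked.fresh T) (subst (λ z → Token (Lift M′) k z (foot z (nextₔ d))) e (Ticked.here T))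
        (λ I″ fr″ ab → clear I″ fr″ λ k<l τ → ab k<l (Ticked.above T k<l τ)) >>= λ I″ T′ →
      reached done I″ (record { up = Ticked.up T′ ; fresh = Ticked.fresh T′ ; here = Ticked.here T′
                              ; above = λ k<l τ → Ticked.above T′ k<l (Ticked.above T k<l τ) })

    leave₂ : Leave 2F
    leave₂ I up fr τ clear = tick 2F I up fr τ λ _ → clear I fr λ _ τ → τ

    leave₁ : Leave 1F
    leave₁ = leave-after 1F (λ ()) refl leave₂

    leave : ∀ d → Leave d
    leave 0F = leave-after 0F (λ ()) refl leave₁
    leave 1F = leave₁
    leave 2F = leave₂

  slide-free : ∀ {m k j} (d : Fin 2) {M} → k < m → k ≤ suc h → Inv (Lift M) → AllUp (Lift M) m → Fresh (Lift M) m →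
    Token (Lift M) k j (foot j (inject₁ d)) →
    (∀ {l i} → k ≡ suc l → ¬ Token (Lift M) l (foot j (suc d)) i) →
    Reached M λ R′ → Ticked (Lift M) R′ m k j (suc d)
  slide-free {k = k} {j} d {M} k<m k≤ I up fr τ free = move I (can-slide I d τ k≤) λ {R′} S I′ →
    ticked-step {Lift M} {R′} k<m up fr
      (λ l≢k τ′ → Advance.Slide.keep I {d = d} τ S l≢k (λ { refl → free refl τ′ }) τ′) S

  next-next : ∀ i → next (next i) ≢ i
  next-next i = proj₁ (next⁴ i)

  -- If the token below stands on the target, it first leaves for the following place. That place is
  -- free of token `k`, whose end is two places behind it on a cycle of length five.
  slide-tick : ∀ {m k j} (d : Fin 2) {M} → (∀ {l} → k ≡ suc l → Tick m l) → k < m → k ≤ suc h →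
    Inv (Lift M) → AllUp (Lift M) m → Fresh (Lift M) m →
    Token (Lift M) k j (foot j (inject₁ d)) → Reached M λ R′ → Ticked (Lift M) R′ m k j (suc d)
  slide-tick {k = zero} d below k<m k≤ I up fr τ = slide-free d k<m k≤ I up fr τ λ ()
  slide-tick {m} {suc l} {j} d {M} below k<m k≤ I up fr τ with up (<-trans (n<1+n l) k<m)
  ... | j′ , i , τ′ with j′ ≟ᶠ foot j (suc d)
  ... | no ne = slide-free d k<m k≤ I up fr τ λ { refl τ″ → ne (Inv.one I τ′ τ″) }
  ... | yes refl with Inv.edges I τ′
  ... | inj₁ (token d′ refl) =
    leave (below refl) d′ I up fr τ′ clear >>= λ {M′} I′ T →
    slide-free d k<m k≤ I′ (Ticked.up T) (Ticked.fresh T) (Ticked.above T (n<1+n l) τ)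
      (λ { refl τ″ → next-≢ _ (Inv.one I′ (Ticked.here T) τ″) }) >>= λ I″ T′ →
    reached done I″ (record { up = Ticked.up T′ ; fresh = Ticked.fresh T′ ; here = Ticked.here T′
                            ; above = λ k<l τ → Ticked.above T′ k<l (Ticked.above T (<-trans (n<1+n l) k<l) τ) })
    where
    clear : ∀ {R′} → Inv R′ → Fresh R′ m → KeptAbove (Lift M) R′ l → Clear R′ l (foot j (suc d))
    clear {R′} I′ _ ab = (λ { (refl , _) → <-irrefl refl k≤ }) , λ j″ u → held j″ u
      where
      held : ∀ j″ → ¬ R′ (s (suc l) (next (foot j (suc d)))) (s (suc (suc l)) j″)
      held j″ u with Inv.one I′ (ab (n<1+n l) τ) (Inv.symm I′ u)
      ... | refl = next-next (foot j (inject₁ d)) (trans (cong next (sym (foot-slide j d)))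
                     (s-index (Inv.uniq I′ (Inv.symm I′ u) (ab (n<1+n l) τ))))

  tick : ∀ {m} k → k < m → m ≤ suc (suc h) → Tick m k
  tick {m} k k<m m≤ d I up fr τ clear = go k k<m d I up fr τ clear
    where
    go : ∀ k → k < m → Tick m k
    go k k<m {M} {j} 2F I up fr τ clear with clear refl
    go k k<m {M} {j} 2F I up fr τ clear | cut , free =
      move I (can-turn I τ cut free (≤-pred (<-≤-trans k<m m≤))) λ {R′} S I′ →
        ticked-step {Lift M} {R′} {d = 0F} k<m up fr (Turn.keep I τ free S)
          (subst (λ z → Step (Lift M) R′ (s (suc k) (next j)) (s k z)) (foot-turn j) S)
    go zero k<m 0F I up fr τ _ = slide-tick 0F (λ ()) k<m z≤n I up fr τ
    go zero k<m 1F I up fr τ _ = slide-tick 1F (λ ()) k<m z≤n I up fr τ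
    go (suc k) k<m 0F I up fr τ _ =
      slide-tick 0F (λ { refl → go k (<-trans (n<1+n k) k<m) }) k<m (≤-pred (<-≤-trans k<m m≤)) I up fr τ
    go (suc k) k<m 1F I up fr τ _ =
      slide-tick 1F (λ { refl → go k (<-trans (n<1+n k) k<m) }) k<m (≤-pred (<-≤-trans k<m m≤)) I up fr τ

  -- Creating all tokens

  Distant : Relation → ℕ → Set
  Distant R m = ∀ {l i} → m ≡ suc l → ¬ Token R l 0F i

  -- The birth of token `m` takes over `s m 0` and would destroy token `m - 1` if its upper end
  -- stood there. With level `m + 1` still empty, that token can always be driven from 0 to 1.
  depart : ∀ {m M} → m ≤ suc h → Inv (Lift M) → AllUp (Lift M) m → Fresh (Lift M) m →
           Reached M λ R′ → AllUp R′ m × Fresh R′ m × Distant R′ m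
  depart {zero} _ I up fr = reached done I (up , fr , λ ())
  depart {suc l} {M} m≤ I up fr with up ≤-refl
  ... | suc j , i , τ = reached done I (up , fr , λ { refl τ′ → contradiction (Inv.one I τ τ′) λ () })
  ... | 0F , i , τ with Inv.edges I τ
  ... | inj₁ (token d refl) = leave (tick l ≤-refl (m≤n⇒m≤1+n m≤)) d I up fr τ clear >>= λ I′ T →
    reached done I′ (Ticked.up T , Ticked.fresh T , λ { refl τ′ → contradiction (Inv.one I′ (Ticked.here T) τ′) λ () })
    where
    clear : ∀ {R′} → Inv R′ → Fresh R′ (suc l) → KeptAbove (Lift M) R′ l → Clear R′ l 0F
    clear I′ fr′ _ = (λ { (_ , ()) }) , λ j′ u → fr′ ≤-refl (Inv.symm I′ u)

  record Sown (R : Relation) (m : ℕ) (p : Player) (i : Fin 5) : Set where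
    constructor mkSown
    field
      seeded  : R p (s (suc m) i)
      alone   : ∀ {i′ w} → R (s (suc m) i′) w → w ≡ p
      fresh   : Fresh R (suc m)
      up      : AllUp R m
      distant : Distant R m

  sown-step : ∀ {R R′ m p i} → Inv R → Sow R p m i → ¬ Occupied R (suc m) i → Step R R′ p (s (suc m) i) →
    (∀ {i′ w} → i′ ≢ i → R (s (suc m) i′) w → w ≡ p) → Fresh R (suc m) → AllUp R m → Distant R m → Sown R′ m p i
  sown-step {R} {R′} {m} {p} {i} I σ free S only fr up far = mkSown (Step.new S) alone fresh′ up′ far′
    where
    alone : ∀ {i′ w} → R′ (s (suc m) i′) w → w ≡ p
    alone r with Step.from S r
    ... | inj₁ (inj₁ (refl , _)) = [ (λ ()) , (λ ()) ]′ (Sow-seed σ)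
    ... | inj₁ (inj₂ (_ , refl)) = refl
    ... | inj₂ (u , (_ , ne) , _) = only (λ { refl → ne refl }) u
    fresh′ : Fresh R′ (suc m)
    fresh′ m<k r with Step.from S r
    ... | inj₁ (inj₁ (refl , _)) = [ (λ ()) , (λ ()) ]′ (Sow-seed σ)
    ... | inj₁ (inj₂ (refl , _)) = <-irrefl refl m<k
    ... | inj₂ (u , _) = fr m<k u
    up′ : AllUp R′ m
    up′ l<m with up l<m
    ... | j , i , τ = j , i , sown I (Sow-seed σ) free S τ
    far′ : Distant R′ m
    far′ refl τ with Step.from S τ
    ... | inj₁ e = seed-move (Sow-seed σ) e
    ... | inj₂ (u , _) = far refl u

  module _ {m} (m≤ : m ≤ suc h) where

    barren-fresh : ∀ {R} → Inv R → Fresh R (suc m) → Dead R (suc m)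
    barren-fresh I fr j i τ = fr ≤-refl τ

    barren-sown : ∀ {R p i} → Seed p m → Sown R m p i → Dead R m
    barren-sown σ T j i τ with Sown.alone T τ | σ
    ... | refl | inj₁ ()
    ... | refl | inj₂ ()

    plant : ∀ {M} → Inv (Lift M) → AllUp (Lift M) m → Fresh (Lift M) m → Distant (Lift M) m →
            Reached M λ R′ → Sown R′ m (b m) 4F
    plant {M} I up fr far = move I (Barren.can-enter I m≤ D D′ (unseeded (inj₂ refl)) (unseeded (inj₁ refl)))
      λ S I′ → sown-step I enter (Barren.unoccupied I m≤ D D′) S (λ _ u → ⊥-elim (fr ≤-refl u))
        (λ m<k → fr (<⇒≤ m<k)) up far
      where
      D : Dead (Lift M) m
      D j i τ = fr ≤-refl τ
      D′ : Dead (Lift M) (suc m)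
      D′ j i τ = fr (n≤1+n m) τ
      unseeded : ∀ {x} → Seed x m → ∀ q → ¬ Lift M x q
      unseeded (inj₁ refl) q r with Inv.edges I r
      ... | inj₁ (sweep _) = fr ≤-refl (Inv.symm I r)
      unseeded (inj₂ refl) q r with Inv.edges I r
      ... | inj₁ (finish _) = fr ≤-refl (Inv.symm I r)

    no-c : ∀ {M i} → Inv (Lift M) → Sown (Lift M) m (b m) i → ∀ q → ¬ Lift M (c m) q
    no-c I T q r with Inv.edges I r
    ... | inj₁ (finish _) = contradiction (Sown.alone T (Inv.symm I r)) λ ()

    lower : ∀ {M i} → i ≢ 0F → i ≢ 4F → Inv (Lift M) → Sown (Lift M) m (b m) (next i) →
            Reached M λ R′ → Sown R′ m (b m) i
    lower i≢0 i≢4 I T = move I (Barren.can-down I m≤ D D′ (no-c I T) i≢0 i≢4 (Sown.seeded T))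
      λ S I′ → sown-step I (down i≢0 i≢4 (Sown.seeded T)) (Barren.unoccupied I m≤ D D′) S
        (λ _ → Sown.alone T) (Sown.fresh T) (Sown.up T) (Sown.distant T)
      where
      D = barren-sown (inj₁ refl) T
      D′ = barren-fresh I (Sown.fresh T)

    hand-over : ∀ {M} → Inv (Lift M) → Sown (Lift M) m (b m) 1F → Reached M λ R′ → Sown R′ m (c m) 1F
    hand-over {M} I T = move I (Barren.can-pass I m≤ D D′ (no-c I T) (Sown.seeded T))
      λ S I′ → sown-step I (pass (Sown.seeded T)) (Barren.unoccupied I m≤ D D′) S
        only (Sown.fresh T) (Sown.up T) (Sown.distant T)
      where
      D = barren-sown (inj₁ refl) T
      D′ = barren-fresh I (Sown.fresh T)
      only : ∀ {i w} → i ≢ 1F → Lift M (s (suc m) i) w → w ≡ c m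
      only ne u with Sown.alone T u
      ... | refl = contradiction (s-index (Inv.uniq I (Inv.symm I u) (Sown.seeded T))) ne

    land : ∀ {M} → Inv (Lift M) → Sown (Lift M) m (c m) 1F → Reached M λ R′ → Sown R′ m (c m) 0F
    land I T = move I (Barren.can-drop I m≤ D D′ (Sown.seeded T))
      λ S I′ → sown-step I (drop (Sown.seeded T)) (Barren.unoccupied I m≤ D D′) S
        (λ _ → Sown.alone T) (Sown.fresh T) (Sown.up T) (Sown.distant T)
      where
      D = barren-sown (inj₂ refl) T
      D′ = barren-fresh I (Sown.fresh T)

    bear : ∀ {M} → Inv (Lift M) → Sown (Lift M) m (c m) 0F → Reached M λ R′ → AllUp R′ (suc m) × Fresh R′ (suc m)
    bear {M} I T = move I (can-birth I (Sown.seeded T) (barren-sown (inj₂ refl) T) m≤) λ {R′} S I′ →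
      (λ {l} → up S) , fresh-step S ≤-refl (Sown.fresh T)
      where
      up : ∀ {R′} → Step (Lift M) R′ (s (suc m) 0F) (s m 0F) → AllUp R′ (suc m)
      up S {l} l≤m with l ≟ m
      ... | yes refl = _ , _ , Step.new S
      ... | no l≢m with Sown.up T (≤∧≢⇒< (≤-pred l≤m) l≢m)
      ... | j , i , τ = j , i , Step.kept S τ
        ((λ { refl → l≢m refl }) , (λ { refl → Sown.distant T refl τ }))
        ((λ { refl → <-irrefl refl l≤m }) , λ { refl → l≢m refl })

    deliver : ∀ {M} → Inv (Lift M) → AllUp (Lift M) m → Fresh (Lift M) m →
              Reached M λ R′ → AllUp R′ (suc m) × Fresh R′ (suc m)
    deliver I up fr = depart m≤ I up fr >>= λ I (up , fr , far) → plant I up fr far >>= λ I T →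
      lower {i = 3F} (λ ()) (λ ()) I T >>= λ I T → lower {i = 2F} (λ ()) (λ ()) I T >>= λ I T →
      lower {i = 1F} (λ ()) (λ ()) I T >>= λ I T → hand-over I T >>= λ I T → land I T >>= λ I T → bear I T

  -- Bottom-up is the possible order, as a token can be born only while the token above is missing.
  populate : ∀ m → m ≤ suc (suc h) → Reached empty λ R → AllUp R m × Fresh R m
  populate zero _ = reached done inv-empty ((λ ()) , λ _ → lift-empty)
  populate (suc m) m≤ = populate m (≤-trans (n≤1+n m) m≤) >>= λ I (up , fr) → deliver (≤-pred m≤) I up fr

  -- Parking the tokens in a stable matching

  position : Fin 5 → Fin 3 → ℕ
  position j d = toℕ j * 3 + toℕ d

  position-last : ∀ j d → position j d ≡ 14 → j ≡ 4F × d ≡ 2F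
  position-last = from-yes (all? λ j → all? λ d → (position j d ≟ 14) →-dec ((j ≟ᶠ 4F) ×-dec (d ≟ᶠ 2F)))

  position-next : ∀ j d → position j d < 14 → position (nextⱼ j d) (nextₔ d) ≡ suc (position j d) × (d ≡ 2F → j ≢ 4F)
  position-next = from-yes (all? λ j → all? λ d → (position j d <? 14) →-dec
    ((position (nextⱼ j d) (nextₔ d) ≟ suc (position j d)) ×-dec ((d ≟ᶠ 2F) →-dec ¬? (j ≟ᶠ 4F))))

  position-≤ : ∀ j d → position j d ≤ 14
  position-≤ = from-yes (all? λ j → all? λ d → position j d ≤? 14)

  next-zero : ∀ j → next j ≡ 0F → j ≡ 4F
  next-zero = from-yes (all? λ j → (next j ≟ᶠ 0F) →-dec (j ≟ᶠ 4F))

  -- All tokens are parked at stage 2 of place 4, and `foot 4F 2F` is `0F`. A parked token `suc k`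
  -- thus holds place 0 of level `suc k` and acts on token `k` as the cut acts on the top token: it
  -- blocks exactly the turn from 4 to 0.
  Capped : Relation → ℕ → Set
  Capped R k = k ≡ suc h ⊎ Token R (suc k) 4F 0F

  capped-clear : ∀ {R k j} → Inv R → Fresh R (suc (suc h)) → Capped R k → j ≢ 4F → Clear R k j
  capped-clear {R} {k} {j} I fr cap j≢4 = (λ (_ , e) → j≢4 e) , none cap
    where
    none : Capped R k → ∀ j′ → ¬ R (s (suc k) (next j)) (s (suc (suc k)) j′)
    none (inj₁ refl) j′ u = fr ≤-refl (Inv.symm I u)
    none (inj₂ τ) j′ u with Inv.one I τ (Inv.symm I u)
    ... | refl = j≢4 (next-zero j (s-index (Inv.uniq I (Inv.symm I u) τ)))

  record Parked (R R′ : Relation) (k : ℕ) : Set where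
    constructor parked
    field
      up    : AllUp R′ (suc (suc h))
      fresh : Fresh R′ (suc (suc h))
      here  : Token R′ k 4F 0F
      above : KeptAbove R R′ k

  park : ∀ {k M} → k ≤ suc h → Inv (Lift M) → AllUp (Lift M) (suc (suc h)) → Fresh (Lift M) (suc (suc h)) →
         Capped (Lift M) k → Reached M λ R′ → Parked (Lift M) R′ k
  park {k} k≤ I up fr cap with up (s≤s k≤)
  ... | j , i , τ with Inv.edges I τ
  ... | inj₁ (token d refl) = go (14 ∸ position j d) (m+[n∸m]≡n (position-≤ j d)) I up fr cap τ
    where
    go : ∀ e {j d M} → position j d + e ≡ 14 → Inv (Lift M) → AllUp (Lift M) (suc (suc h)) →
         Fresh (Lift M) (suc (suc h)) → Capped (Lift M) k → Token (Lift M) k j (foot j d) →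
         Reached M λ R′ → Parked (Lift M) R′ k
    go zero {j} {d} eq I up fr cap τ with position-last j d (trans (sym (+-identityʳ _)) eq)
    ... | refl , refl = reached done I (parked up fr τ λ _ τ → τ)
    go (suc e) {j} {d} eq I up fr cap τ with position-next j d (subst (suc (position j d) ≤_) (trans (sym (+-suc _ e)) eq) (m≤m+n _ e))
    ... | p≡ , j≢4 = tick k (s≤s k≤) ≤-refl d I up fr τ (λ d≡2 → capped-clear I fr cap (j≢4 d≡2)) >>= λ I′ T →
      go e (trans (cong (_+ e) p≡) (trans (sym (+-suc _ e)) eq)) I′ (Ticked.up T) (Ticked.fresh T)
        ([ inj₁ , (λ τ′ → inj₂ (Ticked.above T ≤-refl τ′)) ]′ cap) (Ticked.here T) >>= λ I″ T′ →
      reached done I″ (parked (Parked.up T′) (Parked.fresh T′) (Parked.here T′) λ k<l τ → Parked.above T′ k<l (Ticked.above T k<l τ))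

  Settled : Relation → ℕ → Set
  Settled R k = ∀ {l} → k ≤ l → l ≤ suc h → Token R l 4F 0F

  -- Parking goes from the top down because moving token `k` may displace the tokens below it but
  -- none above.
  settle : ∀ {M} k → k ≤ suc (suc h) → Inv (Lift M) → AllUp (Lift M) (suc (suc h)) → Fresh (Lift M) (suc (suc h)) →
           Settled (Lift M) k → Reached M λ R′ → Settled R′ 0
  settle zero _ I _ _ settled = reached done I settled
  settle {M} (suc k) k≤ I up fr settled = park (≤-pred k≤) I up fr cap >>= λ {M′} I′ T →
    settle k (≤-trans (n≤1+n k) k≤) I′ (Parked.up T) (Parked.fresh T) (extend T)
    where
    cap : Capped (Lift M) k
    cap with k ≟ suc h
    ... | yes eq = inj₁ eq
    ... | no ne  = inj₂ (settled ≤-refl (≤∧≢⇒< (≤-pred k≤) ne))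
    extend : ∀ {R′} → Parked (Lift M) R′ k → Settled R′ k
    extend T {l} k≤l l≤ with l ≟ k
    ... | yes refl = Parked.here T
    ... | no l≢k   = Parked.above T k<l (settled k<l l≤)
      where
      k<l : k < l
      k<l = ≤∧≢⇒< k≤l (≢-sym l≢k)

  -- All tokens are in their last stage, so there is no slide, and each turn is blocked by the
  -- parked token above or by the cut. Place 4 of every level from 1 up is occupied: no seed can
  -- enter there, and by `seed` any seed already on the level would have to be above 4.
  settled-still : ∀ {M p q} → Inv (Lift M) → Settled (Lift M) 0 → Move (Lift M) p q → level q ≤ suc (suc h) → ⊥
  settled-still I settled (slide k j d r) _ with Inv.one I r (settled z≤n (≤-pred (lift-present r)))
  ... | refl with foot-injective 4F (inject₁ d) 2F (s-index (Inv.uniq I r (settled z≤n (≤-pred (lift-present r)))))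
  ... | eq = inject₁≢2 d eq
    where
    inject₁≢2 : ∀ (d : Fin 2) → inject₁ d ≢ 2F
    inject₁≢2 0F ()
    inject₁≢2 1F ()
  settled-still I settled (turn k j r cut free) _ with Inv.one I r (settled z≤n (≤-pred (lift-present r)))
  ... | refl with k ≟ suc h
  ... | yes refl = cut (refl , refl)
  ... | no ne = free 4F (Inv.symm I (settled z≤n (≤∧≢⇒< (≤-pred (lift-present r)) ne)))
  settled-still I settled (birth k r) _ =
    n≮0 (Inv.seed I (inj₂ refl) r (_ , _ , settled z≤n (≤-pred (lift-present (Inv.symm I r)))))
  settled-still I settled (sow enter free) q≤ = free (_ , _ , settled z≤n (≤-pred q≤))
  settled-still I settled (sow (down {i = i} _ _ r) _) q≤ =
    <⇒≱ (Inv.seed I (inj₁ refl) r (_ , _ , settled z≤n (≤-pred q≤))) (toℕ≤pred[n] (next i))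
  settled-still I settled (sow (pass r) _) q≤ with Inv.seed I (inj₁ refl) r (_ , _ , settled z≤n (≤-pred q≤))
  ... | s≤s ()
  settled-still I settled (sow (drop r) _) q≤ with Inv.seed I (inj₂ refl) r (_ , _ , settled z≤n (≤-pred q≤))
  ... | s≤s ()

  settled-stable : ∀ {M} → Inv (Lift M) → Settled (Lift M) 0 → LocallyStable game M
  settled-stable I settled = inv-matching I , λ u v B →
    [ (λ m → settled-still I settled m (player-level v)) , (λ m → settled-still I settled m (player-level u)) ]′ (Move-of I B)

  all-settled : Reached empty λ R → Settled R 0
  all-settled = populate (suc (suc h)) ≤-refl >>= λ I (up , fr) →
    settle (suc (suc h)) ≤-refl I up fr λ n≤l l≤ → contradiction (≤-trans n≤l l≤) 1+n≰n

  stable-reachable : Σ (State size) λ M → Σ ℕ λ t → Reach game empty M t × LocallyStable game M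
  stable-reachable = arrive all-settled
    where
    arrive : Reached empty (λ R → Settled R 0) → Σ (State size) λ M → Σ ℕ λ t → Reach game empty M t × LocallyStable game M
    arrive (reached ρ I settled) = _ , _ , ρ , settled-stable I settled

theorem5 : Σ ℕ λ k → ∀ m → Σ ℕ λ n → m ≤ n × Σ (Game n) λ G →
    WellFormed G × Bipartite G ×
    (Σ (State n) λ M → Σ ℕ λ t → Reach G empty M t × LocallyStable G M) ×
    (∀ (M : State n) (t : ℕ) → Reach G empty M t → LocallyStable G M → 2 ^ (n / suc k) ≤ t)
-- The divisor 24 works because the game has `8 * (m + 3)` players, at most `24 * (m + 1)`, and
-- needs `2 ^ (m + 1)` steps.
theorem5 = 23 , λ m → size m , ≤-trans (m≤n+m m 3) (m≤m*n (3 + m) 8) , game m , wellFormed m , bipartite m ,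
  stable-reachable m , λ M t path stable → ≤-trans (^-monoʳ-≤ 2 (exponent m)) (lower-bound m M t path stable)
  where
  open Construction
  exponent : ∀ m → size m / 24 ≤ suc m
  exponent m = ≤-trans (/-monoˡ-≤ 24 size≤) (≤-reflexive (m*n/n≡m (suc m) 24))
    where
    open ≤-Reasoning
    split : ∀ m → (3 + m) * 8 + m * 16 ≡ suc m * 24
    split = solve-∀
    size≤ : (3 + m) * 8 ≤ suc m * 24
    size≤ = begin
      (3 + m) * 8          ≤⟨ m≤m+n _ (m * 16) ⟩
      (3 + m) * 8 + m * 16 ≡⟨ split m ⟩
      suc m * 24           ∎
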